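{- Let $n_1,n_2\ge 2$, let $S_{n_1,n_2}$ be the double star of order $n_1+n_2$, and let $k\ge 3$. Then the spectrum of the adjacency matrix of the uniform double hyperstar $S_{n_1,n_2}^k$ is $$\sigma_A(S_{n_1,n_2}^k)=\begin{pmatrix}-1 & k-2 & r_1 & r_2 & r_3 & r_4 & r_5\\ (k-2)(n_1+n_2-1)-1 & n_1+n_2-4 & 1&1&1&1&1\end{pmatrix},$$ where $r_1,\dots,r_5$ are the roots (with multiplicity) of the equation \begin{align*} &\lambda^5-(-7+3k)\lambda^4+\bigl(17+3k^2+n_2+n_1-k(14+n_2+n_1)\bigr)\lambda^3\\ &-\bigl(-5(3+n_2+n_1)+k(17+7n_2+7n_1)-k^2(7+2n_2+2n_1)+k^3\bigr)\lambda^2\\ &-\bigl(-1+(-7+12k-6k^2+k^3)n_1+(7-5k+k^2+(1-k)n_1)(-1+k)n_2\bigr)\lambda\\ &-(-1+k)\bigl(-1+n_2+n_1+(3-4k+k^2)n_2n_1\bigr)=0. \end{align*}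
   Context: A hypergraph $G^*=(V,E)$ has a finite vertex set $V=\{v_1,\dots,v_N\}$ and a finite set $E$ of hyperedges, each a subset of $V$. Its adjacency matrix $A=(a_{ij})$ has $a_{ij}=|\{e\in E:\{v_i,v_j\}\subset e\}|$ for $i\ne j$ and $a_{ii}=0$. A star $S_n$ is the tree on $n$ vertices with one central vertex joined to the $n-1$ other vertices. The double star $S_{n_1,n_2}$ is the graph obtained from disjoint stars $S_{n_1}$ and $S_{n_2}$ by adding an edge joining their central vertices. The uniform double hyperstar $S_{n_1,n_2}^k$ is the $k$-th power of $S_{n_1,n_2}$: the $k$-uniform hypergraph obtained by adding to each edge of $S_{n_1,n_2}$ its own $k-2$ new vertices (so the hyperedges are the edges enlarged by pairwise disjoint sets of $k-2$ new vertices). The two-row notation for a spectrum lists eigenvalues in the first row and multiplicities in the second; it is read as a multiset (if listed values coincide, their multiplicities add, and multiplicity $0$ means the entry is absent). -}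

module Defs where

open import Algebra.Apartness.Bundles using (HeytingField; HeytingCommutativeRing)
open import Algebra.Bundles using (CommutativeRing)
open import Algebra.Bundles.Raw using (RawRing)
import Algebra.Definitions.RawMonoid as RawMonoidDefs
import Algebra.Definitions.RawSemiring as RawSemiringDefs
open import Data.Bool.Base using (if_then_else_)
open import Data.Fin.Base using (Fin; zero; suc; toℕ; splitAt; quotient)
open import Data.Fin.Properties using (_≟_; splitAt⁻¹-↑ˡ; splitAt⁻¹-↑ʳ)
open import Data.Fin.Subset using (Subset; inside; outside; ⊥; ⁅_⁆; _∪_; ∣_∣)
open import Data.Fin.Subset.Properties using (_⊆?_; ∣⊥∣≡0; ∣⁅x⁆∣≡1; ∪-identityˡ)
open import Data.Integer.Base using (ℤ; +_; -[1+_])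
open import Data.List.Base using (List; []; _∷_; map; foldr)
open import Data.Nat.Base using (ℕ; zero; suc; _∸_; NonZero)
open import Data.Sum.Base using (_⊎_; inj₁; inj₂; [_,_]′)
open import Data.Vec.Base using (_++_; tabulate; []; _∷_)
open import Data.Vec.Functional using (Vector; removeAt)
open import Data.Vec.Properties using (++-injectiveˡ; ++-injectiveʳ; ∷-injectiveʳ)
open import Function.Definitions using (Injective)
open import Relation.Binary.PropositionalEquality
  using (_≡_; refl; sym; trans; cong; cong₂; module ≡-Reasoning)
open import Relation.Nullary using (does; contradiction; ¬_)

module _ where
  open import Data.Integer.Base using (-_; _+_; _-_; _*_; _^_)

  -- Constant term first, like the elements of polynomialRing.
  quintic : (n₁ n₂ k : ℤ) → List ℤ
  quintic n₁ n₂ k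
    = - ((- + 1 + k) * (- + 1 + n₂ + n₁ + (+ 3 - + 4 * k + k ^ 2) * n₂ * n₁))
    ∷ - (- + 1
         + (- + 7 + + 12 * k - + 6 * k ^ 2 + k ^ 3) * n₁
         + (+ 7 - + 5 * k + k ^ 2 + (+ 1 - k) * n₁) * (- + 1 + k) * n₂)
    ∷ - (- (+ 5 * (+ 3 + n₂ + n₁))
         + k * (+ 17 + + 7 * n₂ + + 7 * n₁)
         - k ^ 2 * (+ 7 + + 2 * n₂ + + 2 * n₁)
         + k ^ 3)
    ∷ + 17 + + 3 * k ^ 2 + n₂ + n₁ - k * (+ 14 + n₂ + n₁)
    ∷ - (- + 7 + + 3 * k)
    ∷ + 1
    ∷ []

open import Data.Nat.Base using (_+_; _*_)

-- The set of hyperedges is enumerated without repetition by Fin size.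
record Hypergraph : Set where
  field
    order          : ℕ
    size           : ℕ
    edge           : Fin size → Subset order
    edge-injective : Injective _≡_ _≡_ edge

open Hypergraph

adjacency : (H : Hypergraph) → Fin (order H) → Fin (order H) → ℕ
adjacency H i j =
  if does (i ≟ j)
  then 0
  else ∣ tabulate (λ e → does (⁅ i ⁆ ∪ ⁅ j ⁆ ⊆? edge H e)) ∣

Uniform : ℕ → Hypergraph → Set
Uniform k H = ∀ e → ∣ edge H e ∣ ≡ k

record Graph : Set where
  field
    hypergraph : Hypergraph
    2-uniform  : Uniform 2 hypergraph

  open Hypergraph hypergraph public

private
  ∣++∣ : ∀ {m n} (p : Subset m) (q : Subset n) → ∣ p ++ q ∣ ≡ ∣ p ∣ + ∣ q ∣
  ∣++∣ []            q = refl
  ∣++∣ (inside  ∷ p) q = cong suc (∣++∣ p q)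
  ∣++∣ (outside ∷ p) q = ∣++∣ p q

  ⁅⁆-injective : ∀ {n} {i j : Fin n} → ⁅ i ⁆ ≡ ⁅ j ⁆ → i ≡ j
  ⁅⁆-injective {i = zero}  {zero}  _  = refl
  ⁅⁆-injective {i = suc i} {suc j} eq = cong suc (⁅⁆-injective (∷-injectiveʳ eq))

  ≢⊥ : ∀ {n k} {p : Subset n} → ∣ p ∣ ≡ suc k → ¬ p ≡ ⊥
  ≢⊥ {n} ∣p∣≡1+k refl with trans (sym (∣⊥∣≡0 n)) ∣p∣≡1+k
  ... | ()

star : (n : ℕ) → .{{NonZero n}} → Graph
star (suc m) = record
  { hypergraph = record
    { order          = suc m
    ; size           = m
    ; edge           = spoke
    ; edge-injective = λ {i} {j} → spoke-injective i j
    }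
  ; 2-uniform = λ i →
      cong suc (trans (cong ∣_∣ (∪-identityˡ ⁅ i ⁆)) (∣⁅x⁆∣≡1 i))
  }
  where
  spoke : Fin m → Subset (suc m)
  spoke i = ⁅ zero ⁆ ∪ ⁅ suc i ⁆

  spoke-injective : ∀ i j → spoke i ≡ spoke j → i ≡ j
  spoke-injective i j eq = ⁅⁆-injective
    (trans (sym (∪-identityˡ ⁅ i ⁆))
      (trans (∷-injectiveʳ eq) (∪-identityˡ ⁅ j ⁆)))

centre : (n : ℕ) → .{{_ : NonZero n}} → Fin (Graph.order (star n))
centre (suc m) = zero

-- The disjoint union of G and H together with the edge {u, v}.
join : (G H : Graph) → Fin (Graph.order G) → Fin (Graph.order H) → Graph
join G H u v = record
  { hypergraph = record
    { order          = G.order + H.order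
    ; size           = suc (G.size + H.size)
    ; edge           = joined
    ; edge-injective = λ {e} {f} → joined-injective e f
    }
  ; 2-uniform = joined-2-uniform
  }
  where
  module G = Graph G
  module H = Graph H

  old : Fin G.size ⊎ Fin H.size → Subset (G.order + H.order)
  old = [ (λ e → G.edge e ++ ⊥) , (λ f → ⊥ ++ H.edge f) ]′

  joined : Fin (suc (G.size + H.size)) → Subset (G.order + H.order)
  joined zero    = ⁅ u ⁆ ++ ⁅ v ⁆
  joined (suc e) = old (splitAt G.size e)

  old≢new : ∀ s → ¬ old s ≡ ⁅ u ⁆ ++ ⁅ v ⁆
  old≢new (inj₁ e) eq =
    ≢⊥ (∣⁅x⁆∣≡1 v) (sym (++-injectiveʳ (G.edge e) ⁅ u ⁆ eq))
  old≢new (inj₂ f) eq =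
    ≢⊥ (∣⁅x⁆∣≡1 u) (sym (++-injectiveˡ ⊥ ⁅ u ⁆ eq))

  old-injective : ∀ s t → old s ≡ old t → s ≡ t
  old-injective (inj₁ e) (inj₁ f) eq =
    cong inj₁ (G.edge-injective (++-injectiveˡ (G.edge e) (G.edge f) eq))
  old-injective (inj₁ e) (inj₂ f) eq =
    contradiction (++-injectiveˡ (G.edge e) ⊥ eq) (≢⊥ (G.2-uniform e))
  old-injective (inj₂ e) (inj₁ f) eq =
    contradiction (sym (++-injectiveˡ ⊥ (G.edge f) eq)) (≢⊥ (G.2-uniform f))
  old-injective (inj₂ e) (inj₂ f) eq =
    cong inj₂ (H.edge-injective (++-injectiveʳ {n = G.order} ⊥ ⊥ eq))

  splitAt-injective : ∀ e f → splitAt G.size e ≡ splitAt G.size f → e ≡ f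
  splitAt-injective e f eq with splitAt G.size e in p | splitAt G.size f in q
  splitAt-injective e f refl | inj₁ _ | inj₁ _ =
    trans (sym (splitAt⁻¹-↑ˡ p)) (splitAt⁻¹-↑ˡ q)
  splitAt-injective e f refl | inj₂ _ | inj₂ _ =
    trans (sym (splitAt⁻¹-↑ʳ p)) (splitAt⁻¹-↑ʳ q)

  joined-injective : ∀ e f → joined e ≡ joined f → e ≡ f
  joined-injective zero    zero    _  = refl
  joined-injective zero    (suc f) eq =
    contradiction (sym eq) (old≢new (splitAt G.size f))
  joined-injective (suc e) zero    eq =
    contradiction eq (old≢new (splitAt G.size e))
  joined-injective (suc e) (suc f) eq =
    cong suc (splitAt-injective e f (old-injective _ _ eq))

  old-2-uniform : ∀ s → ∣ old s ∣ ≡ 2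
  old-2-uniform (inj₁ e) = begin
    ∣ G.edge e ++ ⊥ {H.order} ∣      ≡⟨ ∣++∣ (G.edge e) ⊥ ⟩
    ∣ G.edge e ∣ + ∣ ⊥ {H.order} ∣   ≡⟨ cong₂ _+_ (G.2-uniform e) (∣⊥∣≡0 H.order) ⟩
    2                                ∎
    where open ≡-Reasoning
  old-2-uniform (inj₂ f) = begin
    ∣ ⊥ {G.order} ++ H.edge f ∣      ≡⟨ ∣++∣ (⊥ {G.order}) (H.edge f) ⟩
    ∣ ⊥ {G.order} ∣ + ∣ H.edge f ∣   ≡⟨ cong₂ _+_ (∣⊥∣≡0 G.order) (H.2-uniform f) ⟩
    2                                ∎
    where open ≡-Reasoning

  joined-2-uniform : ∀ e → ∣ joined e ∣ ≡ 2
  joined-2-uniform zero    =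
    trans (∣++∣ ⁅ u ⁆ ⁅ v ⁆) (cong₂ _+_ (∣⁅x⁆∣≡1 u) (∣⁅x⁆∣≡1 v))
  joined-2-uniform (suc e) = old-2-uniform (splitAt G.size e)

doubleStar : (n₁ n₂ : ℕ) → .{{NonZero n₁}} → .{{NonZero n₂}} → Graph
doubleStar n₁ n₂ = join (star n₁) (star n₂) (centre n₁) (centre n₂)

-- Meaningful for k ≥ 2.  The new vertices, Fin (size * (k ∸ 2)), are the
-- pairs of an edge e and an index below k ∸ 2; quotient recovers e.
power : ℕ → Graph → Hypergraph
power k G = record
  { order          = G.order + G.size * (k ∸ 2)
  ; size           = G.size
  ; edge           = λ e → G.edge e ++ tabulate (λ x → does (quotient (k ∸ 2) x ≟ e))
  ; edge-injective = λ eq → G.edge-injective (++-injectiveˡ _ _ eq)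
  }
  where module G = Graph G

doubleHyperstar : (n₁ n₂ k : ℕ) → .{{NonZero n₁}} → .{{NonZero n₂}} → Hypergraph
doubleHyperstar n₁ n₂ k = power k (doubleStar n₁ n₂)

SquareMatrix : ∀ {a} → Set a → ℕ → Set a
SquareMatrix A n = Vector (Vector A n) n

module _ {c ℓ} (R : RawRing c ℓ) where
  open RawRing R renaming (_*_ to _·_)
  open RawMonoidDefs +-rawMonoid using (sum)
  open RawSemiringDefs rawSemiring using (_^_)

  -- Laplace expansion along the first row.
  det : ∀ {n} → SquareMatrix Carrier n → Carrier
  det {zero}  M = 1#
  det {suc n} M = sum λ j →
    (- 1#) ^ toℕ j · M zero j · det (λ i → removeAt (M (suc i)) j)

-- A polynomial is its list of coefficients, constant term first; trailing
-- zeros are allowed, and equality is equality of all coefficients.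
polynomialRing : ∀ {c ℓ} → RawRing c ℓ → RawRing c ℓ
polynomialRing R = record
  { Carrier = List Carrier
  ; _≈_     = λ p q → ∀ n → coeff p n ≈ coeff q n
  ; _+_     = _⊕_
  ; _*_     = _⊛_
  ; -_      = map -_
  ; 0#      = []
  ; 1#      = 1# ∷ []
  }
  where
  open RawRing R renaming (_+_ to _∔_; _*_ to _·_)

  coeff : List Carrier → ℕ → Carrier
  coeff []      _       = 0#
  coeff (a ∷ p) zero    = a
  coeff (a ∷ p) (suc n) = coeff p n

  _⊕_ : List Carrier → List Carrier → List Carrier
  []      ⊕ q       = q
  (a ∷ p) ⊕ []      = a ∷ p
  (a ∷ p) ⊕ (b ∷ q) = a ∔ b ∷ p ⊕ q

  _⊛_ : List Carrier → List Carrier → List Carrier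
  []      ⊛ q = []
  (a ∷ p) ⊛ q = map (a ·_) q ⊕ (0# ∷ p ⊛ q)

-- Heyting fields include the (constructive) real and complex numbers as well as
-- every field with decidable equality.
module Spectra {c ℓ₁ ℓ₂} (K : HeytingField c ℓ₁ ℓ₂) where
  open HeytingField K using (heytingCommutativeRing)
  open CommutativeRing (HeytingCommutativeRing.commutativeRing heytingCommutativeRing) public
    using (Carrier; 0#; 1#; -_; rawRing; +-rawMonoid)
  open RawMonoidDefs +-rawMonoid using (_×_)

  K[X] : RawRing c ℓ₁
  K[X] = polynomialRing rawRing

  module K[X] = RawRing K[X]

  fromℕ : ℕ → Carrier
  fromℕ n = n × 1#

  fromℤ : ℤ → Carrier
  fromℤ (+ n)    = fromℕ n
  fromℤ -[1+ n ] = - fromℕ (suc n)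

  -- det (X I - M)
  charPoly : ∀ {n} → SquareMatrix Carrier n → K[X].Carrier
  charPoly M = det K[X] λ i j →
    (if does (i ≟ j) then - M i j ∷ 1# ∷ [] else - M i j ∷ [])

  -- For a monic polynomial p: the list rs consists of all roots of p, each
  -- occurring as often as its multiplicity; that is, p = ∏ (X - r).
  RootsOf : K[X].Carrier → List Carrier → Set ℓ₁
  RootsOf p rs = p K[X].≈ foldr (λ r q → (- r ∷ 1# ∷ []) K[X].* q) K[X].1# rs

  -- The multiset of eigenvalues, with algebraic multiplicities.
  Spectrum : ∀ {n} → SquareMatrix Carrier n → List Carrier → Set ℓ₁
  Spectrum M σ = RootsOf (charPoly M) σ

  adjacencyMatrix : (H : Hypergraph) → SquareMatrix Carrier (order H)
  adjacencyMatrix H i j = fromℕ (adjacency H i j)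

{-# OPTIONS --safe #-}
module Submission where

-- If a matrix has entries δᵢⱼ t(f i) - B(f i, f j) vⱼ, where f colours the indices, then
-- subtracting the rows of two indices of the same colour leaves t times a difference of unit rows,
-- so the two indices can be merged into one, adding their weights v and splitting off a factor t.
-- Hence the determinant is a product of values of t times the determinant of the same kind of
-- matrix with one index for each colour, weighted by the sums of v over the colour classes.
--
-- This is applied twice to X I - A.  First all vertices of an edge other than the two centres
-- are merged, which gives the powers of X + 1; then the pendant edges at the same centre are
-- merged, which gives the powers of X - (k - 2).  The remaining 5 × 5 determinant, with one index
-- for each centre, for the middle edge and for the pendant edges at each centre, is the quintic.
-- To have every colour represented, indices of weight 0 are adjoined; the factors they introduce
-- are monic linear polynomials and cancel.

open import Defs
open import Algebra.Apartness.Bundles using (HeytingField; HeytingCommutativeRing)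
open import Algebra.Bundles using (CommutativeMonoid; CommutativeRing)
open import Algebra.Bundles.Raw using (RawRing)
import Algebra.Solver.Ring
open import Algebra.Solver.Ring.AlmostCommutativeRing using (_-Raw-AlmostCommutative⟶_; fromCommutativeRing)
open import Data.Bool.Base using (Bool; true; false; if_then_else_; _∧_)
open import Data.Bool.Properties using (∧-comm)
open import Data.Fin.Base using (Fin; zero; suc; toℕ; splitAt; quotient; punchIn; _↑ˡ_; _↑ʳ_)
open import Data.Fin.Patterns
open import Data.Fin.Properties
  using (_≟_; all?; suc-injective; splitAt-↑ˡ; splitAt-↑ʳ; splitAt⁻¹-↑ˡ; splitAt⁻¹-↑ʳ; toℕ-↑ˡ)
open import Data.Fin.Subset using (Subset; ⊥; ⁅_⁆; _∪_; _∈_) renaming (∣_∣ to card)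
open import Data.Fin.Subset.Properties
  using (_⊆?_; _∈?_; x∈p∪q⁺; x∈p∪q⁻; x∈⁅x⁆; x∈⁅y⁆⇒x≡y; ∪-identityˡ)
open import Data.Integer.Base as ℤ using (ℤ; +_; -[1+_])
import Data.Integer.Properties as ℤ
open import Data.List.Base using (List; []; _∷_; _++_; map; foldr; replicate)
open import Data.Maybe.Base using (Maybe; just; nothing)
open import Data.Nat.Base using (ℕ; zero; suc; NonZero; _+_; _*_; _∸_; _≤_; s≤s)
import Data.Nat.Properties as ℕ
open import Data.Product.Base using (_,_)
import Data.Sign.Base as Sign
open import Data.Sum.Base using (inj₁; inj₂; [_,_]′)
open import Data.Vec.Base as Vec using (Vec; []; _∷_; lookup; tabulate)
open import Data.Vec.Functional using (Vector; removeAt; updateAt) renaming (_++_ to infixr 5 _⧺_)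
open import Data.Vec.Functional.Properties using (updateAt-updates; updateAt-minimal)
open import Data.Vec.Properties
  using (lookup-splitAt; lookup∘tabulate; lookup-map; lookup-replicate; tabulate-cong)
open import Function.Base using (_∘_; id; const; flip; case_of_)
open import Function.Bundles using (mk⇔)
open import Level using (_⊔_)
open import Relation.Binary.PropositionalEquality as ≡ using (_≡_; _≢_)
open import Relation.Nullary using (does; yes; no; contradiction)
open import Relation.Nullary.Decidable using (_×-dec_; does-⇔; dec-false; dec-true; from-yes)

-- `Spectrum` and `RootsOf` both assert a factorisation into monic linear polynomials, so the
-- theorem is an identity in K[X]: the characteristic polynomial is a power of X + 1 times a power
-- of X - (k - 2) times the quintic. The obstacle is the diagonal. Distinct vertices of one cell are
-- adjacent to each other, but no vertex is adjacent to itself, so the coloured form must move the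
-- surplus self-adjacency of a cell into t; on edge cells this turns X into X + 1. Between the two
-- mergings the same matrix is presented anew. A pendant cell has weight 1 + d with d = k - 2, and
-- its self-adjacency must become 0, the value between different pendant cells at one centre. Hence
-- t changes there to X + 1 - (1 + d) = X - d. Cancellation in K[X] rests on the regularity of X +
-- a, which is read off the coefficients from the highest down and so involves no decision about
-- equality in K.

punchIn-↑ˡ : ∀ {m} n (j : Fin (suc m)) (k : Fin m) → punchIn (j ↑ˡ n) (k ↑ˡ n) ≡ punchIn j k ↑ˡ n
punchIn-↑ˡ n zero    k       = ≡.refl
punchIn-↑ˡ n (suc j) zero    = ≡.refl
punchIn-↑ˡ n (suc j) (suc k) = ≡.cong suc (punchIn-↑ˡ n j k)

punchIn-↑ʳ : ∀ m {n} (j : Fin (suc m)) (k : Fin n) → punchIn (j ↑ˡ n) (m ↑ʳ k) ≡ suc m ↑ʳ k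
punchIn-↑ʳ m       zero    k = ≡.refl
punchIn-↑ʳ (suc m) (suc j) k = ≡.cong suc (punchIn-↑ʳ m j k)

-- Finite sums in a commutative monoid

module Summation {c ℓ} (M : CommutativeMonoid c ℓ) where
  open CommutativeMonoid M
  open import Algebra.Properties.CommutativeMonoid.Sum M using (sum; sum-cong-≋; sum-replicate;
      sum-replicate-zero; ∑-distrib-+; ∑-comm)
  open import Algebra.Definitions.RawMonoid rawMonoid using (_×_)

  -- Opaque, so that unification can solve for the summand of a sum over Fin (suc n).
  opaque
    ∑ : ∀ {n} → Vector Carrier n → Carrier
    ∑ = sum

    ∑≈sum : ∀ {n} (x : Vector Carrier n) → ∑ x ≈ sum x
    ∑≈sum x = refl

    ∑-empty : (x : Vector Carrier 0) → ∑ x ≈ ε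
    ∑-empty x = refl

    ∑-suc : ∀ {n} (x : Vector Carrier (suc n)) → ∑ x ≈ x zero ∙ ∑ (x ∘ suc)
    ∑-suc x = refl

    ∑-cong : ∀ {n} {x y : Vector Carrier n} → (∀ i → x i ≈ y i) → ∑ x ≈ ∑ y
    ∑-cong = sum-cong-≋

    ∑-zero : ∀ {n} {x : Vector Carrier n} → (∀ i → x i ≈ ε) → ∑ x ≈ ε
    ∑-zero {n} x≈ε = trans (sum-cong-≋ x≈ε) (sum-replicate-zero n)

    ∑-const : ∀ n x → ∑ {n} (λ _ → x) ≈ n × x
    ∑-const n x = sum-replicate n

    ∑-∙ : ∀ {n} (x y : Vector Carrier n) → ∑ (λ i → x i ∙ y i) ≈ ∑ x ∙ ∑ y
    ∑-∙ = ∑-distrib-+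

    ∑-swap : ∀ {m n} (x : Fin m → Fin n → Carrier) → ∑ (λ i → ∑ (x i)) ≈ ∑ (λ j → ∑ (flip x j))
    ∑-swap = ∑-comm

  ∑-++ : ∀ m {n} (x : Vector Carrier (m + n)) → ∑ x ≈ ∑ (x ∘ (_↑ˡ n)) ∙ ∑ (x ∘ (m ↑ʳ_))
  ∑-++ zero    x = trans (sym (identityˡ _)) (∙-congʳ (sym (∑-empty _)))
  ∑-++ (suc m) x = trans (∑-suc x) (trans (∙-congˡ (∑-++ m (x ∘ suc)))
    (trans (sym (assoc _ _ _)) (∙-congʳ (sym (∑-suc _)))))

-- Determinants over a commutative ring

module Determinant {c ℓ} (R : CommutativeRing c ℓ) where
  open CommutativeRing R hiding (zero) renaming (_+_ to _⊞_; _*_ to _·_)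
  open Summation +-commutativeMonoid public
  open Summation *-commutativeMonoid using () renaming
    (∑ to ∏; ∑-suc to ∏-suc; ∑-empty to ∏-empty; ∑-cong to ∏-cong)
  import Algebra.Properties.Semiring.Sum semiring as Sum
  open import Algebra.Definitions.RawSemiring (RawRing.rawSemiring rawRing) using (_^_)
  open import Algebra.Properties.Ring ring
  open import Relation.Binary.Reasoning.Setoid setoid
  open import Algebra.Properties.CommutativeSemigroup *-commutativeSemigroup using (x∙yz≈y∙xz)

  opaque
    unfolding ∑

    *-distribˡ-∑ : ∀ {n} x (y : Vector Carrier n) → x · ∑ y ≈ ∑ (λ i → x · y i)
    *-distribˡ-∑ = Sum.*-distribˡ-sum

    *-distribʳ-∑ : ∀ {n} x (y : Vector Carrier n) → ∑ y · x ≈ ∑ (λ i → y i · x)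
    *-distribʳ-∑ = Sum.*-distribʳ-sum

  Matrix : ℕ → Set c
  Matrix = SquareMatrix Carrier

  ∣_∣ : ∀ {n} → Matrix n → Carrier
  ∣ M ∣ = det rawRing M

  minor : ∀ {n} → Matrix (suc n) → Fin (suc n) → Matrix n
  minor M j i = removeAt (M (suc i)) j

  sign : ∀ {n} → Fin n → Carrier
  sign j = (- 1#) ^ toℕ j

  cofactor-term : ∀ {n} → Matrix (suc n) → Fin (suc n) → Carrier
  cofactor-term M j = sign j · M zero j · ∣ minor M j ∣

  det-suc : ∀ {n} (M : Matrix (suc n)) → ∣ M ∣ ≈ ∑ (cofactor-term M)
  det-suc M = sym (∑≈sum _)

  det-cong : ∀ {n} {M N : Matrix n} → (∀ i j → M i j ≈ N i j) → ∣ M ∣ ≈ ∣ N ∣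
  det-cong {zero}  M≈N = refl
  det-cong {suc n} {M} {N} M≈N = begin
    ∣ M ∣                  ≈⟨ det-suc M ⟩
    ∑ (cofactor-term M)    ≈⟨ ∑-cong (λ j → *-cong (*-congˡ (M≈N zero j))
                                (det-cong λ i k → M≈N (suc i) (punchIn j k))) ⟩
    ∑ (cofactor-term N)    ≈⟨ det-suc N ⟨
    ∣ N ∣                  ∎

  -- In the Laplace expansion, row 0 enters through its entries and every other row through the
  -- minors; this gives the two cases of an induction on r. The three matrices are related
  -- entrywise, so that they may be given by any definitions.
  det-row-linear : ∀ {n} (r : Fin n) a {M N P : Matrix n} →
    (∀ i → i ≢ r → ∀ j → P i j ≈ M i j) → (∀ i → i ≢ r → ∀ j → P i j ≈ N i j) →
    (∀ j → P r j ≈ M r j ⊞ a · N r j) → ∣ P ∣ ≈ ∣ M ∣ ⊞ a · ∣ N ∣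
  det-row-linear {suc n} r a {M} {N} {P} P≈M P≈N Pr = begin
    ∣ P ∣                                ≈⟨ det-suc P ⟩
    ∑ (term P)                           ≈⟨ ∑-cong (linear r P≈M P≈N Pr) ⟩
    ∑ (λ j → term M j ⊞ a · term N j)    ≈⟨ ∑-∙ (term M) _ ⟩
    ∑ (term M) ⊞ ∑ (λ j → a · term N j)
      ≈⟨ +-cong (det-suc M) (trans (*-congˡ (det-suc N)) (*-distribˡ-∑ a (term N))) ⟨
    ∣ M ∣ ⊞ a · ∣ N ∣                    ∎
    where
    term = cofactor-term

    linear : ∀ r →
      (∀ i → i ≢ r → ∀ j → P i j ≈ M i j) → (∀ i → i ≢ r → ∀ j → P i j ≈ N i j) →
      (∀ j → P r j ≈ M r j ⊞ a · N r j) → ∀ j → term P j ≈ term M j ⊞ a · term N j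
    linear zero P≈M P≈N Pr j = begin
      sign j · P zero j · ∣ minor P j ∣
        ≈⟨ *-congʳ (*-congˡ (Pr j)) ⟩
      sign j · (M zero j ⊞ a · N zero j) · ∣ minor P j ∣
        ≈⟨ *-congʳ (trans (distribˡ _ _ _) (+-congˡ (x∙yz≈y∙xz _ _ _))) ⟩
      (sign j · M zero j ⊞ a · (sign j · N zero j)) · ∣ minor P j ∣
        ≈⟨ distribʳ _ _ _ ⟩
      sign j · M zero j · ∣ minor P j ∣ ⊞ a · (sign j · N zero j) · ∣ minor P j ∣
        ≈⟨ +-cong (*-congˡ (det-cong λ i k → P≈M (suc i) (λ ()) (punchIn j k)))
                  (trans (*-assoc _ _ _)
                    (*-congˡ (*-congˡ (det-cong λ i k → P≈N (suc i) (λ ()) (punchIn j k))))) ⟩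
      term M j ⊞ a · term N j ∎
    linear (suc r) P≈M P≈N Pr j = begin
      sign j · P zero j · ∣ minor P j ∣
        ≈⟨ *-congˡ (det-row-linear r a
             (λ i i≢r k → P≈M (suc i) (i≢r ∘ suc-injective) (punchIn j k))
             (λ i i≢r k → P≈N (suc i) (i≢r ∘ suc-injective) (punchIn j k))
             (λ k → Pr (punchIn j k))) ⟩
      sign j · P zero j · (∣ minor M j ∣ ⊞ a · ∣ minor N j ∣)
        ≈⟨ trans (distribˡ _ _ _) (+-congˡ (x∙yz≈y∙xz _ _ _)) ⟩
      sign j · P zero j · ∣ minor M j ∣ ⊞ a · (sign j · P zero j · ∣ minor N j ∣)
        ≈⟨ +-cong (*-congʳ (*-congˡ (P≈M zero (λ ()) j)))
                  (*-congˡ (*-congʳ (*-congˡ (P≈N zero (λ ()) j)))) ⟩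
      term M j ⊞ a · term N j ∎

  -- Expansion along row 0 and then of each minor along its column 0. The result is symmetric in
  -- rows and columns, which is what transposition invariance will use. That invariance is assumed
  -- here for the two smaller sizes, so that the induction in `det-flip` can supply it.
  det-expand₂ : ∀ {n} (M : Matrix (suc (suc n))) →
    (∀ (A : Matrix (suc n)) → ∣ flip A ∣ ≈ ∣ A ∣) → (∀ (A : Matrix n) → ∣ flip A ∣ ≈ ∣ A ∣) →
    ∣ M ∣ ≈ 1# · M zero zero · ∣ minor M zero ∣ ⊞ ∑ λ j → ∑ λ i →
      - 1# · (sign j · sign i) · (M zero (suc j) · M (suc i) zero)
        · ∣ (λ a b → M (suc (punchIn i a)) (suc (punchIn j b))) ∣
  det-expand₂ M flip₁ flip₂ = trans (det-suc M) (trans (∑-suc _) (+-congˡ (∑-cong λ j → begin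
    - 1# · sign j · M zero (suc j) · ∣ minor M (suc j) ∣
      ≈⟨ *-congˡ (flip₁ (minor M (suc j))) ⟨
    - 1# · sign j · M zero (suc j) · ∣ flip (minor M (suc j)) ∣
      ≈⟨ trans (*-congˡ (det-suc (flip (minor M (suc j))))) (*-distribˡ-∑ _ _) ⟩
    (∑ λ i → - 1# · sign j · M zero (suc j) ·
      (sign i · M (suc i) zero · ∣ minor (flip (minor M (suc j))) i ∣))
      ≈⟨ ∑-cong (λ i → trans (*-congˡ (*-congˡ (flip₂ _))) (rearrange _ _ _ _ _ _)) ⟩
    (∑ λ i → - 1# · (sign j · sign i) · (M zero (suc j) · M (suc i) zero)
      · ∣ (λ a b → M (suc (punchIn i a)) (suc (punchIn j b))) ∣) ∎)))
    where
    open import Algebra.Solver.CommutativeMonoid *-commutativeMonoid using (solve; _⊜_; _⊕_)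
    rearrange : ∀ m s x s′ y d → m · s · x · (s′ · y · d) ≈ m · (s · s′) · (x · y) · d
    rearrange = solve 6 (λ m s x s′ y d →
      (((m ⊕ s) ⊕ x) ⊕ ((s′ ⊕ y) ⊕ d)) ⊜ ((m ⊕ (s ⊕ s′)) ⊕ (x ⊕ y)) ⊕ d) refl

  -- Transposing M only exchanges the two summations in `det-expand₂` and transposes the smaller
  -- minors.
  det-flip : ∀ {n} (M : Matrix n) → ∣ flip M ∣ ≈ ∣ M ∣
  det-flip {zero}        M = refl
  det-flip {suc zero}    M = refl
  det-flip {suc (suc n)} M = begin
    ∣ flip M ∣
      ≈⟨ det-expand₂ (flip M) det-flip det-flip ⟩
    1# · M zero zero · ∣ flip (minor M zero) ∣ ⊞ (∑ λ j → ∑ λ i →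
      - 1# · (sign j · sign i) · (M (suc j) zero · M zero (suc i))
        · ∣ (λ a b → M (suc (punchIn j b)) (suc (punchIn i a))) ∣)
      ≈⟨ +-cong (*-congˡ (det-flip (minor M zero))) (∑-swap _) ⟩
    1# · M zero zero · ∣ minor M zero ∣ ⊞ (∑ λ i → ∑ λ j →
      - 1# · (sign j · sign i) · (M (suc j) zero · M zero (suc i))
        · ∣ (λ a b → M (suc (punchIn j b)) (suc (punchIn i a))) ∣)
      ≈⟨ +-congˡ (∑-cong λ i → ∑-cong λ j →
           *-cong (*-cong (*-congˡ (*-comm _ _)) (*-comm _ _))
             (det-flip λ a b → M (suc (punchIn j a)) (suc (punchIn i b)))) ⟩
    1# · M zero zero · ∣ minor M zero ∣ ⊞ (∑ λ j → ∑ λ i →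
      - 1# · (sign j · sign i) · (M zero (suc j) · M (suc i) zero)
        · ∣ (λ a b → M (suc (punchIn i a)) (suc (punchIn j b))) ∣)
      ≈⟨ det-expand₂ M det-flip det-flip ⟨
    ∣ M ∣ ∎

  -- The first two terms of the expansion have equal minors and opposite signs; every later minor
  -- still contains both equal columns.
  det-columns-0-1 : ∀ {n} (M : Matrix (suc (suc n))) →
    (∀ i → M i zero ≈ M i (suc zero)) → ∣ M ∣ ≈ 0#
  det-columns-0-1 M eq = begin
    ∣ M ∣                                  ≈⟨ trans (det-suc M) (trans (∑-suc _) (+-congˡ (∑-suc _))) ⟩
    t₀ ⊞ (t₁ ⊞ ∑ rest)                     ≈⟨ +-congˡ (+-congˡ (∑-zero (rest-zero M eq))) ⟩
    t₀ ⊞ (t₁ ⊞ 0#)                         ≈⟨ +-congˡ (+-identityʳ t₁) ⟩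
    t₀ ⊞ t₁                                ≈⟨ +-congʳ (*-cong (*-congˡ (eq zero)) (det-cong same)) ⟩
    1# · x · d ⊞ (- 1#) · 1# · x · d
      ≈⟨ +-cong (*-congʳ (*-identityˡ x)) (*-congʳ (trans (*-congʳ (*-identityʳ _)) (-1*x≈-x x))) ⟩
    x · d ⊞ (- x) · d                      ≈⟨ +-congˡ (-‿distribˡ-* x d) ⟨
    x · d ⊞ - (x · d)                      ≈⟨ -‿inverseʳ _ ⟩
    0#                                     ∎
    where
    t₀ = 1# · M zero zero · ∣ minor M zero ∣
    t₁ = (- 1#) · 1# · M zero (suc zero) · ∣ minor M (suc zero) ∣
    rest = λ j → sign (suc (suc j)) · M zero (suc (suc j)) · ∣ minor M (suc (suc j)) ∣
    x = M zero (suc zero)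
    d = ∣ minor M (suc zero) ∣
    same : ∀ i j → minor M zero i j ≈ minor M (suc zero) i j
    same i zero    = sym (eq (suc i))
    same i (suc j) = refl
    rest-zero : ∀ {n} (M : Matrix (suc (suc n))) → (∀ i → M i zero ≈ M i (suc zero)) → ∀ j →
      sign (suc (suc j)) · M zero (suc (suc j)) · ∣ minor M (suc (suc j)) ∣ ≈ 0#
    rest-zero {suc n} M eq j =
      trans (*-congˡ (det-columns-0-1 (minor M (suc (suc j))) (eq ∘ suc))) (zeroʳ _)

  -- With x = row 0 = row (j + 2) and y = row 1, the vanishing of the determinant with both
  -- rows 1 and j + 2 equal to y + x leaves, by linearity, the determinant in question.
  det-rows-0-suc : ∀ {n} (M : Matrix (suc n)) (j : Fin n) →
    (∀ c → M zero c ≈ M (suc j) c) → ∣ M ∣ ≈ 0#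
  det-rows-0-suc M zero eq =
    trans (sym (det-flip M)) (det-columns-0-1 (flip M) eq)
  det-rows-0-suc {suc (suc n)} M (suc j) eq = begin
    ∣ M ∣                            ≈⟨ det-cong M≈ ⟩
    ∣ P y x ∣                        ≈⟨ +-identityˡ _ ⟨
    0# ⊞ ∣ P y x ∣                   ≈⟨ +-congʳ (equal y) ⟨
    ∣ P y y ∣ ⊞ ∣ P y x ∣            ≈⟨ linear₂ y y ⟨
    ∣ P y y+x ∣                      ≈⟨ +-identityʳ _ ⟨
    ∣ P y y+x ∣ ⊞ 0#
      ≈⟨ +-congˡ (trans (sym (det-flip (P x y+x))) (det-columns-0-1 (flip (P x y+x)) λ _ → refl)) ⟨
    ∣ P y y+x ∣ ⊞ ∣ P x y+x ∣        ≈⟨ linear₁ y+x ⟨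
    ∣ P y+x y+x ∣                    ≈⟨ equal y+x ⟩
    0#                               ∎
    where
    x = M zero
    y = M (suc zero)
    y+x = λ c → y c ⊞ x c

    P : (a b : Vector Carrier _) → Matrix _
    P a b zero          = x
    P a b (suc zero)    = a
    P a b (suc (suc i)) = updateAt (λ i → M (suc (suc i))) j (const b) i

    at-j : ∀ a b c → P a b (suc (suc j)) c ≡ b c
    at-j a b c = ≡.cong (λ r → r c) (updateAt-updates j (λ i → M (suc (suc i))))

    off-j : ∀ a b i → i ≢ j → ∀ c → P a b (suc (suc i)) c ≡ M (suc (suc i)) c
    off-j a b i i≢j c = ≡.cong (λ r → r c) (updateAt-minimal i j (λ i → M (suc (suc i))) i≢j)

    M≈ : ∀ i c → M i c ≈ P y x i c
    M≈ zero          c = refl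
    M≈ (suc zero)    c = refl
    M≈ (suc (suc i)) c with i ≟ j
    ... | yes ≡.refl = trans (sym (eq c)) (reflexive (≡.sym (at-j y x c)))
    ... | no i≢j     = reflexive (≡.sym (off-j y x i i≢j c))

    -- Deleting row 0 turns the two copies of `a` into rows 0 and j + 1 of each minor, so the
    -- induction hypothesis for j applies.
    equal : ∀ a → ∣ P a a ∣ ≈ 0#
    equal a = trans (det-suc (P a a)) (∑-zero λ k → trans
      (*-congˡ (det-rows-0-suc (minor (P a a) k) j λ c →
        reflexive (≡.sym (at-j a a (punchIn k c)))))
      (zeroʳ _))

    linear₁ : ∀ b → ∣ P y+x b ∣ ≈ ∣ P y b ∣ ⊞ ∣ P x b ∣
    linear₁ b = trans
      (det-row-linear (suc zero) 1# (off y) (off x) (λ c → +-congˡ (sym (*-identityˡ _))))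
      (+-congˡ (*-identityˡ _))
      where
      off : ∀ a i → i ≢ suc zero → ∀ c → P y+x b i c ≈ P a b i c
      off a zero          i≢ c = refl
      off a (suc zero)    i≢ c = contradiction ≡.refl i≢
      off a (suc (suc i)) i≢ c = refl

    linear₂ : ∀ a b → ∣ P a (λ c → b c ⊞ x c) ∣ ≈ ∣ P a b ∣ ⊞ ∣ P a x ∣
    linear₂ a b = trans
      (det-row-linear (suc (suc j)) 1# (off b) (off x) (λ c → trans (reflexive (at-j a _ c))
        (+-cong (reflexive (≡.sym (at-j a b c)))
                (sym (trans (*-identityˡ _) (reflexive (at-j a x c)))))))
      (+-congˡ (*-identityˡ _))
      where
      off : ∀ b′ i → i ≢ suc (suc j) → ∀ c → P a (λ c → b c ⊞ x c) i c ≈ P a b′ i c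
      off b′ zero          i≢ c = refl
      off b′ (suc zero)    i≢ c = refl
      off b′ (suc (suc i)) i≢ c = reflexive (≡.trans (off-j a _ i (i≢ ∘ ≡.cong (λ i → suc (suc i))) c)
                                             (≡.sym (off-j a b′ i (i≢ ∘ ≡.cong (λ i → suc (suc i))) c)))

  det-row-0 : ∀ {n} (M : Matrix (suc n)) → (∀ c → M zero (suc c) ≈ 0#) →
    ∣ M ∣ ≈ M zero zero · ∣ minor M zero ∣
  det-row-0 M M0≈0 = begin
    ∣ M ∣                                          ≈⟨ trans (det-suc M) (∑-suc _) ⟩
    1# · M zero zero · ∣ minor M zero ∣ ⊞ ∑ (cofactor-term M ∘ suc)
      ≈⟨ +-cong (*-congʳ (*-identityˡ _))
           (∑-zero λ j → trans (*-congʳ (trans (*-congˡ (M0≈0 j)) (zeroʳ _))) (zeroˡ _)) ⟩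
    M zero zero · ∣ minor M zero ∣ ⊞ 0#            ≈⟨ +-identityʳ _ ⟩
    M zero zero · ∣ minor M zero ∣                 ∎

  only : ∀ {n} → Fin n → Fin n → Carrier → Carrier
  only i j x = if does (i ≟ j) then x else 0#

  only-cong : ∀ {n} (i j : Fin n) {x y} → x ≈ y → only i j x ≈ only i j y
  only-cong i j x≈y with does (i ≟ j)
  ... | true  = x≈y
  ... | false = refl

  only-≡ : ∀ {n} (i : Fin n) x → only i i x ≡ x
  only-≡ i x with i ≟ i
  ... | yes _  = ≡.refl
  ... | no i≢i = contradiction ≡.refl i≢i

  only-≢ : ∀ {n} {i j : Fin n} → i ≢ j → ∀ x → only i j x ≡ 0#
  only-≢ {i = i} {j} i≢j x with i ≟ j
  ... | yes i≡j = contradiction i≡j i≢j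
  ... | no _    = ≡.refl

  det-diagonal : ∀ {n} (M : Matrix n) (x : Vector Carrier n) →
    (∀ i j → M i j ≈ only i j (x i)) → ∣ M ∣ ≈ ∏ x
  det-diagonal {zero}  M x M≈ = sym (∏-empty x)
  det-diagonal {suc n} M x M≈ = trans (det-row-0 M (λ c → M≈ zero (suc c)))
    (trans (*-cong (M≈ zero zero) (det-diagonal _ (x ∘ suc) λ i j → M≈ (suc i) (suc j)))
      (sym (∏-suc x)))

  addRow : ∀ {n} → Fin n → Matrix (suc n) → Matrix (suc n)
  addRow j M zero    c = M zero c
  addRow j M (suc i) c = M (suc i) c ⊞ only j i (M zero c)

  det-addRow : ∀ {n} (j : Fin n) (M : Matrix (suc n)) → ∣ addRow j M ∣ ≈ ∣ M ∣
  det-addRow {n} j M = begin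
    ∣ addRow j M ∣       ≈⟨ det-row-linear (suc j) 1# off-M off-N
                              (λ c → +-congˡ (sym (trans (*-identityˡ _) (reflexive (≡.trans
                                (at-j c) (≡.sym (only-≡ j (M zero c)))))))) ⟩
    ∣ M ∣ ⊞ 1# · ∣ N ∣
      ≈⟨ +-congˡ (trans (*-congˡ (det-rows-0-suc N j λ c → reflexive (≡.sym (at-j c)))) (zeroʳ _)) ⟩
    ∣ M ∣ ⊞ 0#           ≈⟨ +-identityʳ _ ⟩
    ∣ M ∣                ∎
    where
    N : Matrix (suc n)
    N zero    c = M zero c
    N (suc i) c = if does (j ≟ i) then M zero c else M (suc i) c

    at-j : ∀ c → N (suc j) c ≡ M zero c
    at-j c with j ≟ j
    ... | yes _  = ≡.refl
    ... | no j≢j = contradiction ≡.refl j≢j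

    off-M : ∀ i → i ≢ suc j → ∀ c → addRow j M i c ≈ M i c
    off-M zero    i≢ c = refl
    off-M (suc i) i≢ c = trans (+-congˡ (reflexive (only-≢ (i≢ ∘ ≡.cong suc ∘ ≡.sym) _))) (+-identityʳ _)

    off-N : ∀ i → i ≢ suc j → ∀ c → addRow j M i c ≈ N i c
    off-N zero    i≢ c = refl
    off-N (suc i) i≢ c with j ≟ i
    ... | yes ≡.refl = contradiction ≡.refl i≢
    ... | no _       = +-identityʳ _

  -- Add column 0 to column j + 1; then row 0 becomes row j + 1 plus t times the first unit row.
  det-merge : ∀ {n} (M : Matrix (suc n)) (j : Fin n) t →
    M zero zero ≈ M (suc j) zero ⊞ t →
    (∀ c → M zero (suc c) ⊞ only j c t ≈ M (suc j) (suc c)) →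
    ∣ M ∣ ≈ t · ∣ (λ a b → M (suc a) (suc b) ⊞ only j b (M (suc a) zero)) ∣
  det-merge {n} M j t M₀₀ M₀ = begin
    ∣ M ∣                                  ≈⟨ det-flip M ⟨
    ∣ flip M ∣                             ≈⟨ det-addRow j (flip M) ⟨
    ∣ addRow j (flip M) ∣                  ≈⟨ det-flip (addRow j (flip M)) ⟨
    ∣ M′ ∣                                 ≈⟨ det-row-linear zero t (off (M′ (suc j))) (off unit) row₀ ⟩
    ∣ with-row₀ (M′ (suc j)) ∣ ⊞ t · ∣ with-row₀ unit ∣
      ≈⟨ +-congʳ (det-rows-0-suc (with-row₀ (M′ (suc j))) j λ c → refl) ⟩
    0# ⊞ t · ∣ with-row₀ unit ∣            ≈⟨ +-identityˡ _ ⟩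
    t · ∣ with-row₀ unit ∣
      ≈⟨ *-congˡ (trans (det-row-0 (with-row₀ unit) λ c → refl) (*-identityˡ _)) ⟩
    t · ∣ (λ a b → M′ (suc a) (suc b)) ∣   ∎
    where
    M′ = flip (addRow j (flip M))

    unit : Vector Carrier (suc n)
    unit zero    = 1#
    unit (suc c) = 0#

    with-row₀ : Vector Carrier (suc n) → Matrix (suc n)
    with-row₀ x zero    = x
    with-row₀ x (suc i) = M′ (suc i)

    off : ∀ x i → i ≢ zero → ∀ c → M′ i c ≈ with-row₀ x i c
    off x zero    i≢ c = contradiction ≡.refl i≢
    off x (suc i) i≢ c = refl

    row₀ : ∀ c → M′ zero c ≈ M′ (suc j) c ⊞ t · unit c
    row₀ zero    = trans M₀₀ (+-congˡ (sym (*-identityʳ t)))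
    row₀ (suc c) = begin
      M zero (suc c) ⊞ only j c (M zero zero)                         ≈⟨ +-congˡ (only-⊞ c) ⟩
      M zero (suc c) ⊞ (only j c t ⊞ only j c (M (suc j) zero))       ≈⟨ +-assoc _ _ _ ⟨
      M zero (suc c) ⊞ only j c t ⊞ only j c (M (suc j) zero)         ≈⟨ +-congʳ (M₀ c) ⟩
      M (suc j) (suc c) ⊞ only j c (M (suc j) zero)                   ≈⟨ +-identityʳ _ ⟨
      M (suc j) (suc c) ⊞ only j c (M (suc j) zero) ⊞ 0#              ≈⟨ +-congˡ (zeroʳ t) ⟨
      M (suc j) (suc c) ⊞ only j c (M (suc j) zero) ⊞ t · 0#          ∎
      where
      only-⊞ : ∀ c → only j c (M zero zero) ≈ only j c t ⊞ only j c (M (suc j) zero)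
      only-⊞ c with does (j ≟ c)
      ... | true  = trans M₀₀ (+-comm _ _)
      ... | false = sym (+-identityˡ 0#)

  det-block-triangular : ∀ m {n} (M : Matrix (m + n)) → (∀ i j → M (i ↑ˡ n) (m ↑ʳ j) ≈ 0#) →
    ∣ M ∣ ≈ ∣ (λ i j → M (i ↑ˡ n) (j ↑ˡ n)) ∣ · ∣ (λ i j → M (m ↑ʳ i) (m ↑ʳ j)) ∣
  det-block-triangular zero        M M≈0 = sym (*-identityˡ _)
  det-block-triangular (suc m) {n} M M≈0 = begin
    ∣ M ∣
      ≈⟨ trans (det-suc M) (∑-++ (suc m) _) ⟩
    ∑ (λ j → cofactor-term M (j ↑ˡ n)) ⊞ ∑ (λ j → cofactor-term M (suc m ↑ʳ j))
      ≈⟨ +-cong (∑-cong left) (∑-zero λ j →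
           trans (*-congʳ (trans (*-congˡ (M≈0 zero j)) (zeroʳ _))) (zeroˡ _)) ⟩
    ∑ (λ j → cofactor-term A j · ∣ D ∣) ⊞ 0#
      ≈⟨ +-identityʳ _ ⟩
    ∑ (λ j → cofactor-term A j · ∣ D ∣)
      ≈⟨ *-distribʳ-∑ _ _ ⟨
    ∑ (cofactor-term A) · ∣ D ∣
      ≈⟨ *-congʳ (det-suc A) ⟨
    ∣ A ∣ · ∣ D ∣ ∎
    where
    A : Matrix (suc m)
    A i j = M (i ↑ˡ n) (j ↑ˡ n)
    D : Matrix n
    D i j = M (suc m ↑ʳ i) (suc m ↑ʳ j)

    left : ∀ j → cofactor-term M (j ↑ˡ n) ≈ cofactor-term A j · ∣ D ∣
    left j = begin
      sign (j ↑ˡ n) · A zero j · ∣ minor M (j ↑ˡ n) ∣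
        ≈⟨ *-cong (*-congʳ (reflexive (≡.cong ((- 1#) ^_) (toℕ-↑ˡ j n))))
             (det-block-triangular m (minor M (j ↑ˡ n)) λ i k →
               trans (reflexive (≡.cong (M (suc (i ↑ˡ n))) (punchIn-↑ʳ m j k))) (M≈0 (suc i) k)) ⟩
      sign j · A zero j · (∣ (λ i k → minor M (j ↑ˡ n) (i ↑ˡ n) (k ↑ˡ n)) ∣ · ∣ (λ i k → minor M (j ↑ˡ n)
          (m ↑ʳ i) (m ↑ʳ k)) ∣)
        ≈⟨ *-congˡ (*-cong
             (det-cong λ i k → reflexive (≡.cong (M (suc (i ↑ˡ n))) (punchIn-↑ˡ n j k)))
             (det-cong λ i k → reflexive (≡.cong (M (suc (m ↑ʳ i))) (punchIn-↑ʳ m j k)))) ⟩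
      sign j · A zero j · (∣ minor A j ∣ · ∣ D ∣)
        ≈⟨ *-assoc _ _ _ ⟨
      cofactor-term A j · ∣ D ∣ ∎

  -- Merging indices of equal colour

  module Quotient {q} (t : Vector Carrier q) (B : Matrix q) where

    weighted : ∀ {n} → (Fin n → Fin q) → Vector Carrier n → Matrix n
    weighted f v i j = only i j (t (f i)) ⊞ - (B (f i) (f j) · v j)

    fibreSum : ∀ {n} → (Fin n → Fin q) → Vector Carrier n → Vector Carrier q
    fibreSum f v c = ∑ λ i → only (f i) c (v i)

    weighted-cong : ∀ {n} {f g : Fin n → Fin q} {v w : Vector Carrier n} →
      (∀ i → f i ≡ g i) → (∀ i → v i ≈ w i) → ∀ i j → weighted f v i j ≈ weighted g w i j
    weighted-cong f≡g v≈w i j = +-cong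
      (reflexive (≡.cong (only i j ∘ t) (f≡g i)))
      (-‿cong (*-cong (reflexive (≡.cong₂ B (f≡g i) (f≡g j))) (v≈w j)))

    det-weights-cong : ∀ {n} (f : Fin n → Fin q) {v w : Vector Carrier n} →
      (∀ i → v i ≈ w i) → ∣ weighted f v ∣ ≈ ∣ weighted f w ∣
    det-weights-cong f v≈w = det-cong (weighted-cong (λ _ → ≡.refl) v≈w)

    det-weighted-merge : ∀ {n} (f : Fin (suc n) → Fin q) v j → f zero ≡ f (suc j) →
      ∣ weighted f v ∣ ≈ t (f zero) · ∣ weighted (f ∘ suc) (λ i → v (suc i) ⊞ only j i (v zero)) ∣
    det-weighted-merge f v j f0≡fj = trans
      (det-merge (weighted f v) j (t (f zero))
        (trans (+-comm _ _) (+-congʳ (trans (-‿cong (*-congʳ (reflexive (≡.cong (λ c → B c (f zero)) f0≡fj))))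
          (sym (+-identityˡ _)))))
        (λ c → trans (+-comm _ _) (+-cong
          (reflexive (≡.cong (only j c ∘ t) f0≡fj))
          (trans (+-identityˡ _) (-‿cong (*-congʳ (reflexive (≡.cong (λ d → B d (f (suc c))) f0≡fj))))))))
      (*-congˡ (det-cong λ a b → trans (+-assoc _ _ _) (+-congˡ (begin
        - (B (f (suc a)) (f (suc b)) · v (suc b)) ⊞ only j b (0# ⊞ - (B (f (suc a)) (f zero) · v zero))
          ≈⟨ +-congˡ (merged a b) ⟩
        - (B (f (suc a)) (f (suc b)) · v (suc b)) ⊞ - (B (f (suc a)) (f (suc b)) · only j b (v zero))
          ≈⟨ -‿+-comm _ _ ⟩
        - (B (f (suc a)) (f (suc b)) · v (suc b) ⊞ B (f (suc a)) (f (suc b)) · only j b (v zero))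
          ≈⟨ -‿cong (distribˡ _ _ _) ⟨
        - (B (f (suc a)) (f (suc b)) · (v (suc b) ⊞ only j b (v zero))) ∎))))
      where
      merged : ∀ a b → only j b (0# ⊞ - (B (f (suc a)) (f zero) · v zero)) ≈
                       - (B (f (suc a)) (f (suc b)) · only j b (v zero))
      merged a b with j ≟ b
      ... | yes ≡.refl = trans (+-identityˡ _) (-‿cong (*-congʳ (reflexive (≡.cong (B (f (suc a))) f0≡fj))))
      ... | no _       = sym (trans (-‿cong (zeroʳ _)) -0#≈0#)

    ++-suc : ∀ {a} {A : Set a} {m} (f : Fin (suc m) → A) (g : Fin q → A) i → (f ⧺ g) (suc i) ≡ ((f ∘ suc) ⧺ g) i
    ++-suc {m = m} f g i with splitAt m i
    ... | inj₁ _ = ≡.refl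
    ... | inj₂ _ = ≡.refl

    ++-↑ˡ : ∀ {a} {A : Set a} {m n} (f : Fin m → A) (g : Fin n → A) i → (f ⧺ g) (i ↑ˡ n) ≡ f i
    ++-↑ˡ {m = m} {n} f g i rewrite splitAt-↑ˡ m i n = ≡.refl

    ++-↑ʳ : ∀ {a} {A : Set a} {m n} (f : Fin m → A) (g : Fin n → A) i → (f ⧺ g) (m ↑ʳ i) ≡ g i
    ++-↑ʳ {m = m} {n} f g i rewrite splitAt-↑ʳ m n i = ≡.refl

    -- Since `id` lists each colour once, index 0 always finds the partner `m ↑ʳ f zero` of its own
    -- colour. The weights `w` are arbitrary because each absorption changes the weight of one
    -- representative.
    det-absorb : ∀ {m} (f : Fin m → Fin q) (v : Vector Carrier m) (w : Vector Carrier q) →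
      ∣ weighted (f ⧺ id) (v ⧺ w) ∣ ≈ ∏ (t ∘ f) · ∣ weighted id (λ c → w c ⊞ fibreSum f v c) ∣
    det-absorb {zero}  f v w = begin
      ∣ weighted id w ∣
        ≈⟨ det-weights-cong id (λ c → sym (trans (+-congˡ (∑-empty _)) (+-identityʳ _))) ⟩
      ∣ weighted id _ ∣        ≈⟨ *-identityˡ _ ⟨
      1# · ∣ weighted id _ ∣   ≈⟨ *-congʳ (∏-empty _) ⟨
      _ ∎
    det-absorb {suc m} f v w = begin
      ∣ weighted (f ⧺ id) (v ⧺ w) ∣
        ≈⟨ det-weighted-merge (f ⧺ id) (v ⧺ w) (m ↑ʳ f zero)
             (≡.sym (≡.trans (++-suc f id (m ↑ʳ f zero)) (++-↑ʳ (f ∘ suc) id (f zero)))) ⟩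
      t (f zero) · ∣ weighted ((f ⧺ id) ∘ suc) (λ i → (v ⧺ w) (suc i) ⊞ only (m ↑ʳ f zero) i (v zero)) ∣
        ≈⟨ *-congˡ (det-cong (weighted-cong (++-suc f id) λ i → trans (+-congʳ (reflexive (++-suc v w i)))
            (weights i))) ⟩
      t (f zero) · ∣ weighted ((f ∘ suc) ⧺ id) ((v ∘ suc) ⧺ w′) ∣
        ≈⟨ *-congˡ (det-absorb (f ∘ suc) (v ∘ suc) w′) ⟩
      t (f zero) · (∏ (t ∘ f ∘ suc) · ∣ weighted id (λ c → w′ c ⊞ fibreSum (f ∘ suc) (v ∘ suc) c) ∣)
        ≈⟨ *-assoc _ _ _ ⟨
      t (f zero) · ∏ (t ∘ f ∘ suc) · ∣ weighted id (λ c → w′ c ⊞ fibreSum (f ∘ suc) (v ∘ suc) c) ∣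
        ≈⟨ *-cong (sym (∏-suc _)) (det-weights-cong id (λ c →
             trans (+-assoc _ _ _) (+-congˡ (sym (∑-suc _))))) ⟩
      ∏ (t ∘ f) · ∣ weighted id (λ c → w c ⊞ fibreSum f v c) ∣ ∎
      where
      w′ : Vector Carrier q
      w′ c = w c ⊞ only (f zero) c (v zero)

      weights : ∀ i → ((v ∘ suc) ⧺ w) i ⊞ only (m ↑ʳ f zero) i (v zero) ≈ ((v ∘ suc) ⧺ w′) i
      weights i with splitAt m i in eq
      ... | inj₁ k = trans (+-congˡ
          (reflexive (only-≢ (λ e → case ≡.trans (≡.sym (splitAt-↑ʳ m q (f zero)))
          (≡.trans (≡.cong (splitAt m) e) eq) of λ ()) _))) (+-identityʳ _)
      ... | inj₂ k = +-congˡ (≡.subst (λ i → only (m ↑ʳ f zero) i (v zero) ≈ only (f zero) k (v zero))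
                       (splitAt⁻¹-↑ʳ eq) (shifted m))
        where
        shifted : ∀ m → only (m ↑ʳ f zero) (m ↑ʳ k) (v zero) ≈ only (f zero) k (v zero)
        shifted zero    = refl
        shifted (suc m) = shifted m

    -- The left-hand side is the determinant of weighted f v bordered by one item of weight 0
    -- for each colour; absorbing all other items into these gives the right-hand side.
    det-quotient : ∀ {m} (f : Fin m → Fin q) (v : Vector Carrier m) →
      ∣ weighted f v ∣ · ∏ t ≈ ∏ (t ∘ f) · ∣ weighted id (fibreSum f v) ∣
    det-quotient {m} f v = begin
      ∣ weighted f v ∣ · ∏ t
        -- A column of weight 0 vanishes off the diagonal. Hence the bordered matrix is block
        -- triangular, and its lower right block is diagonal with entries `t`.
        ≈⟨ *-cong (det-cong λ i j → sym (upper i j))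
                  (sym (det-diagonal _ t lower)) ⟩
      ∣ (λ i j → W (i ↑ˡ q) (j ↑ˡ q)) ∣ · ∣ (λ i j → W (m ↑ʳ i) (m ↑ʳ j)) ∣
        ≈⟨ det-block-triangular m W off ⟨
      ∣ W ∣
        ≈⟨ det-absorb f v (λ _ → 0#) ⟩
      ∏ (t ∘ f) · ∣ weighted id (λ c → 0# ⊞ fibreSum f v c) ∣
        ≈⟨ *-congˡ (det-weights-cong id (λ c → +-identityˡ _)) ⟩
      ∏ (t ∘ f) · ∣ weighted id (fibreSum f v) ∣ ∎
      where
      W : Matrix (m + q)
      W = weighted (f ⧺ id) (v ⧺ λ _ → 0#)

      no-weight : ∀ i j → - (B ((f ⧺ id) i) ((f ⧺ id) (m ↑ʳ j)) · (v ⧺ λ _ → 0#) (m ↑ʳ j)) ≈ 0#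
      no-weight i j = trans (-‿cong (trans (*-congˡ (reflexive (++-↑ʳ v (λ _ → 0#) j))) (zeroʳ _))) -0#≈0#

      only-↑ˡ : ∀ {m} (i j : Fin m) x → only (i ↑ˡ q) (j ↑ˡ q) x ≡ only i j x
      only-↑ˡ zero    zero    x = ≡.refl
      only-↑ˡ zero    (suc j) x = ≡.refl
      only-↑ˡ (suc i) zero    x = ≡.refl
      only-↑ˡ (suc i) (suc j) x = only-↑ˡ i j x

      only-↑ʳ : ∀ m (i j : Fin q) x → only (m ↑ʳ i) (m ↑ʳ j) x ≡ only i j x
      only-↑ʳ zero    i j x = ≡.refl
      only-↑ʳ (suc m) i j x = only-↑ʳ m i j x

      only-↑ : ∀ {m} (i : Fin m) (j : Fin q) x → only (i ↑ˡ q) (m ↑ʳ j) x ≡ 0#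
      only-↑ zero    j x = ≡.refl
      only-↑ (suc i) j x = only-↑ i j x

      upper : ∀ i j → W (i ↑ˡ q) (j ↑ˡ q) ≈ weighted f v i j
      upper i j = +-cong
        (reflexive (≡.trans (only-↑ˡ i j _) (≡.cong (only i j ∘ t) (++-↑ˡ f id i))))
        (-‿cong (*-cong (reflexive (≡.cong₂ B (++-↑ˡ f id i) (++-↑ˡ f id j))) (reflexive (++-↑ˡ v _ j))))

      lower : ∀ i j → W (m ↑ʳ i) (m ↑ʳ j) ≈ only i j (t i)
      lower i j = trans (+-cong (reflexive (≡.trans (only-↑ʳ m i j _) (≡.cong (only i j ∘ t) (++-↑ʳ f id i))))
        (no-weight (m ↑ʳ i) j)) (+-identityʳ _)

      off : ∀ i j → W (i ↑ˡ q) (m ↑ʳ j) ≈ 0#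
      off i j = trans (+-cong (reflexive (only-↑ i j _)) (no-weight (i ↑ˡ q) j)) (+-identityʳ 0#)

-- Incidence and adjacency in the double hyperstar

does-∈? : ∀ {n} (i : Fin n) (p : Subset n) → does (i ∈? p) ≡ lookup p i
does-∈? zero    (true  ∷ p) = ≡.refl
does-∈? zero    (false ∷ p) = ≡.refl
does-∈? (suc i) (_ ∷ p)     = does-∈? i p

does-pair-⊆? : ∀ {n} (i j : Fin n) (p : Subset n) →
  does (⁅ i ⁆ ∪ ⁅ j ⁆ ⊆? p) ≡ lookup p i ∧ lookup p j
does-pair-⊆? i j p = ≡.trans
  (does-⇔ (mk⇔
      (λ ⊆p → ⊆p (x∈p∪q⁺ (inj₁ (x∈⁅x⁆ i))) , ⊆p (x∈p∪q⁺ {p = ⁅ i ⁆} (inj₂ (x∈⁅x⁆ j))))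
      (λ { (i∈p , j∈p) x∈ → [ (λ x∈i → ≡.subst (_∈ p) (≡.sym (x∈⁅y⁆⇒x≡y i x∈i)) i∈p)
                            , (λ x∈j → ≡.subst (_∈ p) (≡.sym (x∈⁅y⁆⇒x≡y j x∈j)) j∈p) ]′ (x∈p∪q⁻ ⁅ i ⁆ ⁅ j ⁆ x∈)
                                }))
    (⁅ i ⁆ ∪ ⁅ j ⁆ ⊆? p) (i ∈? p ×-dec j ∈? p))
  (≡.cong₂ _∧_ (does-∈? i p) (does-∈? j p))

lookup-⁅⁆ : ∀ {n} (i j : Fin n) → lookup ⁅ i ⁆ j ≡ does (j ≟ i)
lookup-⁅⁆ zero    zero    = ≡.refl
lookup-⁅⁆ zero    (suc j) = lookup-replicate j false
lookup-⁅⁆ (suc i) zero    = ≡.refl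
lookup-⁅⁆ (suc i) (suc j) = lookup-⁅⁆ i j

count-false : ∀ {n} (f : Fin n → Bool) → (∀ i → f i ≡ false) → card (tabulate f) ≡ 0
count-false {zero}  f f≡ = ≡.refl
count-false {suc n} f f≡ rewrite f≡ zero = count-false (f ∘ suc) (f≡ ∘ suc)

count-∧-≟ : ∀ {n} (f : Fin n → Bool) i → card (tabulate (λ j → f j ∧ does (i ≟ j))) ≡ (if f i then 1 else 0)
count-∧-≟ {suc n} f zero with f zero
... | true  = ≡.cong suc (count-false (λ j → f (suc j) ∧ false) λ j → ∧-comm (f (suc j)) false)
... | false = count-false (λ j → f (suc j) ∧ false) λ j → ∧-comm (f (suc j)) false
count-∧-≟ {suc n} f (suc i) with f zero
... | true  = count-∧-≟ (f ∘ suc) i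
... | false = count-∧-≟ (f ∘ suc) i

-- The parameters are n₁ - 1, n₂ - 1 and k - 2: the numbers of pendant edges at the two centres and
-- the number of new vertices on each edge.
module Cells (m₁ m₂ d : ℕ) where

  size : ℕ
  size = suc (m₁ + m₂)

  H : Hypergraph
  H = doubleHyperstar (suc m₁) (suc m₂) (suc (suc d))

  open Hypergraph H using (order; edge)

  -- The two centres are 0F and 1F; all other vertices of the edge e form the cell 2 + e.
  -- Edge 0 joins the centres, followed by the edges at the first and at the second centre.
  Cell : Set
  Cell = Fin (suc (suc size))

  cellˡ : Fin (suc m₁) → Cell
  cellˡ zero    = 0F
  cellˡ (suc i) = suc (suc (suc (i ↑ˡ m₂)))

  cellʳ : Fin (suc m₂) → Cell
  cellʳ zero    = 1F
  cellʳ (suc j) = suc (suc (suc (m₁ ↑ʳ j)))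

  oldCell : Fin (suc m₁ + suc m₂) → Cell
  oldCell i = [ cellˡ , cellʳ ]′ (splitAt (suc m₁) i)

  newCell : Fin (size * d) → Cell
  newCell x = suc (suc (quotient d x))

  cell : Fin order → Cell
  cell i = [ oldCell , newCell ]′ (splitAt (suc m₁ + suc m₂) i)

  incident : Cell → Fin size → Bool
  incident zero          zero    = true
  incident zero          (suc e) = [ const true , const false ]′ (splitAt m₁ e)
  incident (suc zero)    zero    = true
  incident (suc zero)    (suc e) = [ const false , const true ]′ (splitAt m₁ e)
  incident (suc (suc f)) e       = does (f ≟ e)

  ↑ˡ≢↑ʳ : ∀ {m n} (i : Fin m) (j : Fin n) → i ↑ˡ n ≢ m ↑ʳ j
  ↑ˡ≢↑ʳ (suc i) j eq = ↑ˡ≢↑ʳ i j (Data.Fin.Properties.suc-injective eq)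

  does-↑ˡ : ∀ {m} n (i j : Fin m) → does (i ≟ j) ≡ does (i ↑ˡ n ≟ j ↑ˡ n)
  does-↑ˡ n zero    zero    = ≡.refl
  does-↑ˡ n zero    (suc j) = ≡.refl
  does-↑ˡ n (suc i) zero    = ≡.refl
  does-↑ˡ n (suc i) (suc j) = does-↑ˡ n i j

  does-↑ʳ : ∀ m {n} (i j : Fin n) → does (i ≟ j) ≡ does (m ↑ʳ i ≟ m ↑ʳ j)
  does-↑ʳ zero    i j = ≡.refl
  does-↑ʳ (suc m) i j = does-↑ʳ m i j

  lookup-oldEdge : ∀ e i → lookup (Graph.edge (doubleStar (suc m₁) (suc m₂)) e) i ≡ incident (oldCell i) e
  lookup-oldEdge zero i
    rewrite lookup-splitAt (suc m₁) ⁅ zero {m₁} ⁆ ⁅ zero {m₂} ⁆ i with splitAt (suc m₁) i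
  ... | inj₁ zero    = ≡.refl
  ... | inj₁ (suc j) = lookup-replicate j false
  ... | inj₂ zero    = ≡.refl
  ... | inj₂ (suc j) = lookup-replicate j false
  lookup-oldEdge (suc e) i with splitAt m₁ e in eq
  ... | inj₁ f rewrite lookup-splitAt (suc m₁) (⁅ zero ⁆ ∪ ⁅ suc f ⁆) (⊥ {suc m₂}) i with splitAt (suc m₁) i
  ...   | inj₁ zero rewrite eq = ≡.refl
  ...   | inj₁ (suc j) = ≡.trans (≡.cong (λ p → lookup p j) (∪-identityˡ ⁅ f ⁆)) (≡.trans (lookup-⁅⁆ f j)
            (≡.trans (does-↑ˡ m₂ j f) (≡.cong (λ e → does (j ↑ˡ m₂ ≟ e)) (splitAt⁻¹-↑ˡ eq))))
  ...   | inj₂ zero rewrite eq = ≡.refl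
  ...   | inj₂ (suc j) = ≡.trans (lookup-replicate j false) (≡.sym (dec-false (m₁ ↑ʳ j ≟ e)
            λ { ≡.refl → ↑ˡ≢↑ʳ f j (splitAt⁻¹-↑ˡ eq) }))
  lookup-oldEdge (suc e) i | inj₂ f rewrite lookup-splitAt (suc m₁) (⊥ {suc m₁}) (⁅ zero ⁆ ∪ ⁅ suc f ⁆) i with
      splitAt (suc m₁) i
  ...   | inj₁ zero rewrite eq = ≡.refl
  ...   | inj₁ (suc j) = ≡.trans (lookup-replicate j false) (≡.sym (dec-false (j ↑ˡ m₂ ≟ e)
            λ { ≡.refl → ↑ˡ≢↑ʳ j f (≡.sym (splitAt⁻¹-↑ʳ eq)) }))
  ...   | inj₂ zero rewrite eq = ≡.refl
  ...   | inj₂ (suc j) = ≡.trans (≡.cong (λ p → lookup p j) (∪-identityˡ ⁅ f ⁆)) (≡.trans (lookup-⁅⁆ f j)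
            (≡.trans (does-↑ʳ m₁ j f) (≡.cong (λ e → does (m₁ ↑ʳ j ≟ e)) (splitAt⁻¹-↑ʳ eq))))

  lookup-edge : ∀ e i → lookup (edge e) i ≡ incident (cell i) e
  lookup-edge e i
    rewrite lookup-splitAt (suc m₁ + suc m₂) (Graph.edge (doubleStar (suc m₁) (suc m₂)) e)
              (tabulate (λ x → does (quotient d x ≟ e))) i
    with splitAt (suc m₁ + suc m₂) i
  ... | inj₁ j = lookup-oldEdge e j
  ... | inj₂ x = lookup∘tabulate _ x

  -- For two distinct vertices this is their adjacency, also when they lie in the same cell. For a
  -- single vertex it is the degree, where the adjacency matrix has 0 instead.
  common : Cell → Cell → ℕ
  common a b = card (tabulate (λ e → incident a e ∧ incident b e))

  adjacency-cell : ∀ i j → adjacency H i j ≡ (if does (i ≟ j) then 0 else common (cell i) (cell j))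
  adjacency-cell i j = ≡.cong (λ n → if does (i ≟ j) then 0 else n) (≡.cong card (tabulate-cong λ e →
    ≡.trans (does-pair-⊆? i j (edge e)) (≡.cong₂ _∧_ (lookup-edge e i) (lookup-edge e j))))

  common-comm : ∀ a b → common a b ≡ common b a
  common-comm a b = ≡.cong card (tabulate-cong λ e → ∧-comm (incident a e) (incident b e))

  -- A vertex other than a centre lies on exactly one edge, so only that edge can contribute to the
  -- count.
  common-edge : ∀ a e → common a (suc (suc e)) ≡ (if incident a e then 1 else 0)
  common-edge a e = count-∧-≟ (incident a) e

  common-edge-self : ∀ e → common (suc (suc e)) (suc (suc e)) ≡ 1
  common-edge-self e = ≡.trans (common-edge (suc (suc e)) e) (≡.cong (λ b → if b then 1 else 0)
      (dec-true (e ≟ e) ≡.refl))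

  common-centres : common 0F 1F ≡ 1
  common-centres = ≡.cong suc (count-false (λ e → incident 0F (suc e) ∧ incident 1F (suc e)) no-edge)
    where
    no-edge : ∀ e → incident 0F (suc e) ∧ incident 1F (suc e) ≡ false
    no-edge e with splitAt m₁ e
    ... | inj₁ _ = ≡.refl
    ... | inj₂ _ = ≡.refl

  -- The cells of the pendant edges at the first centre get the colour 3F, those at the second 4F.
  pendantColour : Fin (m₁ + m₂) → Fin 5
  pendantColour e = [ const 3F , const 4F ]′ (splitAt m₁ e)

  colour : Cell → Fin 5
  colour zero                = 0F
  colour (suc zero)          = 1F
  colour (suc (suc zero))    = 2F
  colour (suc (suc (suc e))) = pendantColour e

-- The diagonal follows the second merging. Distinct pendant cells at the same centre share no edge,
-- hence 0 for the colours 3F and 4F. The other colours consist of one cell each, so their entries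
-- are a convention to be matched by the diagonal term: 0 for the centres, and for the middle edge
-- the value 1 that `common` has there.
adjacent : Fin 5 → Fin 5 → ℕ
adjacent i j = Vec.lookup (Vec.lookup table i) j
  where
  table =
    (0 ∷ 1 ∷ 1 ∷ 1 ∷ 0 ∷ []) ∷
    (1 ∷ 0 ∷ 1 ∷ 0 ∷ 1 ∷ []) ∷
    (1 ∷ 1 ∷ 1 ∷ 0 ∷ 0 ∷ []) ∷
    (1 ∷ 0 ∷ 0 ∷ 0 ∷ 0 ∷ []) ∷
    (0 ∷ 1 ∷ 0 ∷ 0 ∷ 0 ∷ []) ∷ []

adjacent-comm : ∀ i j → adjacent i j ≡ adjacent j i
adjacent-comm = from-yes (all? λ i → all? λ j → adjacent i j ℕ.≟ adjacent j i)

module _ (m₁ m₂ d : ℕ) where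
  open Cells m₁ m₂ d

  common-edge≡adjacent : ∀ a e → a ≢ suc (suc e) →
      common a (suc (suc e)) ≡ adjacent (colour a) (colour (suc (suc e)))
  common-edge≡adjacent a e a≢e = ≡.trans (common-edge a e) (go a e a≢e)
    where
    go : ∀ a e → a ≢ suc (suc e) → (if incident a e then 1 else 0) ≡ adjacent (colour a) (colour (suc (suc e)))
    go zero       zero    _ = ≡.refl
    go (suc zero) zero    _ = ≡.refl
    go zero       (suc e) _ with splitAt m₁ e
    ... | inj₁ _ = ≡.refl
    ... | inj₂ _ = ≡.refl
    go (suc zero) (suc e) _ with splitAt m₁ e
    ... | inj₁ _ = ≡.refl
    ... | inj₂ _ = ≡.refl
    go (suc (suc zero))    zero    a≢e = contradiction ≡.refl a≢e
    go (suc (suc zero))    (suc e) _ with splitAt m₁ e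
    ... | inj₁ _ = ≡.refl
    ... | inj₂ _ = ≡.refl
    go (suc (suc (suc f))) zero    _ with splitAt m₁ f
    ... | inj₁ _ = ≡.refl
    ... | inj₂ _ = ≡.refl
    go (suc (suc (suc f))) (suc e) a≢e rewrite dec-false (f ≟ e)
        (λ f≡e → a≢e (≡.cong (λ e → suc (suc (suc e))) f≡e))
      with splitAt m₁ e | splitAt m₁ f
    ... | inj₁ _ | inj₁ _ = ≡.refl
    ... | inj₁ _ | inj₂ _ = ≡.refl
    ... | inj₂ _ | inj₁ _ = ≡.refl
    ... | inj₂ _ | inj₂ _ = ≡.refl

  -- Equal cells must be excluded: a pendant cell has `common` equal to 1 with itself, but its
  -- colour has 0 in the table. By symmetry everything except the pairs of centres reduces to an
  -- edge cell in the second place.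
  common≡adjacent : ∀ a b → a ≢ b → common a b ≡ adjacent (colour a) (colour b)
  common≡adjacent a             (suc (suc e)) a≢b = common-edge≡adjacent a e a≢b
  common≡adjacent (suc (suc e)) zero          a≢b = ≡.trans (common-comm (suc (suc e)) 0F)
    (≡.trans (common-edge≡adjacent 0F e (a≢b ∘ ≡.sym)) (adjacent-comm 0F (colour (suc (suc e)))))
  common≡adjacent (suc (suc e)) (suc zero)    a≢b = ≡.trans (common-comm (suc (suc e)) 1F)
    (≡.trans (common-edge≡adjacent 1F e (a≢b ∘ ≡.sym)) (adjacent-comm 1F (colour (suc (suc e)))))
  common≡adjacent zero          zero          a≢b = contradiction ≡.refl a≢b
  common≡adjacent zero          (suc zero)    a≢b = common-centres
  common≡adjacent (suc zero)    zero          a≢b = ≡.trans (common-comm 1F 0F) common-centres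
  common≡adjacent (suc zero)    (suc zero)    a≢b = contradiction ≡.refl a≢b

-- The 5 × 5 determinant as a polynomial identity over the integers

module IntegerPolynomials {c ℓ} (R : CommutativeRing c ℓ)
  (ψ-homo : ℤ.+-*-rawRing -Raw-AlmostCommutative⟶ fromCommutativeRing R) where
  open CommutativeRing R hiding (zero) renaming (_+_ to _⊞_; _*_ to _·_)
  open _-Raw-AlmostCommutative⟶_ ψ-homo public renaming (⟦_⟧ to ψ)
  open Determinant R
  open import Algebra.Definitions.RawSemiring (RawRing.rawSemiring rawRing) using (_^_; sum)
  open import Relation.Binary.Reasoning.Setoid setoid

  ψ-≟ : ∀ i j → Maybe (ψ i ≈ ψ j)
  ψ-≟ i j with i ℤ.≟ j
  ... | yes i≡j = just (reflexive (≡.cong ψ i≡j))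
  ... | no _    = nothing

  open Algebra.Solver.Ring ℤ.+-*-rawRing (fromCommutativeRing R) ψ-homo ψ-≟ public
    hiding (_^N_; ⟦_⟧N; ⟦_⟧H)

  -- `det` uses only the operations of a ring, none of its laws. Over this raw ring of solver
  -- expressions, the determinant of a matrix of expressions is again an expression and can be
  -- normalised.
  polynomials : ℕ → RawRing _ _
  polynomials m = record
    { Carrier = Polynomial m
    ; _≈_ = _≡_ ; _+_ = _:+_ ; _*_ = _:*_ ; -_ = :-_ ; 0# = con ℤ.0ℤ ; 1# = con ℤ.1ℤ }

  module _ {m} (ρ : Env m) where
    private
      module S = RawRing (polynomials m)
      open import Algebra.Definitions.RawSemiring S.rawSemiring using () renaming (_^_ to _^ₛ_; sum to sumₛ)

    ⟦sum⟧ : ∀ {n} (x : Vector (Polynomial m) n) → ⟦ sumₛ x ⟧ ρ ≈ sum (λ i → ⟦ x i ⟧ ρ)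
    ⟦sum⟧ {zero}  x = 0-homo
    ⟦sum⟧ {suc n} x = +-congˡ (⟦sum⟧ (x ∘ suc))

    ⟦^⟧ : ∀ p n → ⟦ p ^ₛ n ⟧ ρ ≈ (⟦ p ⟧ ρ) ^ n
    ⟦^⟧ p zero    = 1-homo
    ⟦^⟧ p (suc n) = *-congˡ (⟦^⟧ p n)

    ^-cong : ∀ {x y} n → x ≈ y → x ^ n ≈ y ^ n
    ^-cong zero    x≈y = refl
    ^-cong (suc n) x≈y = *-cong x≈y (^-cong n x≈y)

    ⟦det⟧ : ∀ {n} (P : SquareMatrix (Polynomial m) n) →
      ⟦ det (polynomials m) P ⟧ ρ ≈ ∣ (λ i j → ⟦ P i j ⟧ ρ) ∣
    ⟦det⟧ {zero}  P = 1-homo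
    ⟦det⟧ {suc n} P = begin
      ⟦ det (polynomials m) P ⟧ ρ
        ≈⟨ ⟦sum⟧ (λ j → ((:- con ℤ.1ℤ) ^ₛ toℕ j) :* P zero j :* det (polynomials m)
            (λ i k → P (suc i) (punchIn j k))) ⟩
      sum (λ j → ⟦ (:- con ℤ.1ℤ) ^ₛ toℕ j ⟧ ρ · ⟦ P zero j ⟧ ρ · ⟦ det (polynomials m)
          (λ i k → P (suc i) (punchIn j k)) ⟧ ρ)
        ≈⟨ ∑≈sum _ ⟨
      ∑ (λ j → ⟦ (:- con ℤ.1ℤ) ^ₛ toℕ j ⟧ ρ · ⟦ P zero j ⟧ ρ · ⟦ det (polynomials m)
          (λ i k → P (suc i) (punchIn j k)) ⟧ ρ)
        ≈⟨ ∑-cong (λ j → *-cong (*-congʳ (trans (⟦^⟧ (:- con ℤ.1ℤ) (toℕ j)) (^-cong (toℕ j) (-‿cong 1-homo))))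
             (⟦det⟧ (λ i k → P (suc i) (punchIn j k)))) ⟩
      ∑ (cofactor-term (λ i j → ⟦ P i j ⟧ ρ))
        ≈⟨ det-suc (λ i j → ⟦ P i j ⟧ ρ) ⟨
      ∣ (λ i j → ⟦ P i j ⟧ ρ) ∣ ∎

  -- `quintic` consists of integers, computed before they are mapped into the ring, whereas the
  -- solver interprets expressions in the ring itself. Evaluation in the integers bridges the two.
  evalℤ : ∀ {m} → Polynomial m → Vec ℤ m → ℤ
  evalℤ (op [+] p q) ρ = evalℤ p ρ ℤ.+ evalℤ q ρ
  evalℤ (op [*] p q) ρ = evalℤ p ρ ℤ.* evalℤ q ρ
  evalℤ (con i)      ρ = i
  evalℤ (var x)      ρ = lookup ρ x
  evalℤ (p :^ n)     ρ = evalℤ p ρ ℤ.^ n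
  evalℤ (:- p)       ρ = ℤ.- evalℤ p ρ

  ψ-evalℤ : ∀ {m} (p : Polynomial m) ρ → ψ (evalℤ p ρ) ≈ ⟦ p ⟧ (Vec.map ψ ρ)
  ψ-evalℤ (op [+] p q) ρ = trans (+-homo _ _) (+-cong (ψ-evalℤ p ρ) (ψ-evalℤ q ρ))
  ψ-evalℤ (op [*] p q) ρ = trans (*-homo _ _) (*-cong (ψ-evalℤ p ρ) (ψ-evalℤ q ρ))
  ψ-evalℤ (con i)      ρ = refl
  ψ-evalℤ (var x)      ρ = reflexive (≡.sym (lookup-map x ψ ρ))
  ψ-evalℤ (p :^ n)     ρ = ψ-power n
    where
    ψ-power : ∀ n → ψ (evalℤ p ρ ℤ.^ n) ≈ ⟦ p :^ n ⟧ (Vec.map ψ ρ)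
    ψ-power zero    = 1-homo
    ψ-power (suc n) = trans (*-homo _ _) (*-cong (ψ-evalℤ p ρ) (ψ-power n))
  ψ-evalℤ (:- p)       ρ = trans (-‿homo _) (-‿cong (ψ-evalℤ p ρ))

  eval : Carrier → List ℤ → Carrier
  eval x = foldr (λ i y → ψ i ⊞ x · y) (ψ ℤ.0ℤ)

  eval-map : ∀ {m} x (ps : List (Polynomial m)) σ →
    eval x (map (λ p → evalℤ p σ) ps) ≈ foldr (λ p y → ⟦ p ⟧ (Vec.map ψ σ) ⊞ x · y) (ψ ℤ.0ℤ) ps
  eval-map x []       σ = refl
  eval-map x (p ∷ ps) σ = +-cong (ψ-evalℤ p σ) (*-congˡ (eval-map x ps σ))

  infix 10 #_
  #_ : ∀ {m} → ℕ → Polynomial m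
  # n = con (+ n)

  quinticₚ : ∀ {m} (μ₁ μ₂ δ : Polynomial m) → List (Polynomial m)
  quinticₚ μ₁ μ₂ δ
    = :- ((:- # 1 :+ k) :* (:- # 1 :+ n₂ :+ n₁ :+ (# 3 :- # 4 :* k :+ k :^ 2) :* n₂ :* n₁))
    ∷ :- (:- # 1
         :+ (:- # 7 :+ # 12 :* k :- # 6 :* k :^ 2 :+ k :^ 3) :* n₁
         :+ (# 7 :- # 5 :* k :+ k :^ 2 :+ (# 1 :- k) :* n₁) :* (:- # 1 :+ k) :* n₂)
    ∷ :- (:- (# 5 :* (# 3 :+ n₂ :+ n₁))
         :+ k :* (# 17 :+ # 7 :* n₂ :+ # 7 :* n₁)
         :- k :^ 2 :* (# 7 :+ # 2 :* n₂ :+ # 2 :* n₁)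
         :+ k :^ 3)
    ∷ # 17 :+ # 3 :* k :^ 2 :+ n₂ :+ n₁ :- k :* (# 14 :+ n₂ :+ n₁)
    ∷ :- (:- # 7 :+ # 3 :* k)
    ∷ # 1
    ∷ []
    where
    n₁ = # 1 :+ μ₁
    n₂ = # 1 :+ μ₂
    k  = # 2 :+ δ

  X̂ μ̂₁ μ̂₂ δ̂ : Polynomial 4
  X̂  = var 0F
  μ̂₁ = var 1F
  μ̂₂ = var 2F
  δ̂  = var 3F

  -- The weights are the numbers of vertices of each colour: the middle edge has d vertices besides
  -- the centres, a pendant edge 1 + d besides its centre. The entry X - d is X + 1 less the weight
  -- 1 + d of one pendant cell.
  diagonalₚ weightₚ : Vector (Polynomial 4) 5
  diagonalₚ = Vec.lookup (X̂ ∷ X̂ ∷ X̂ :+ # 1 ∷ X̂ :- δ̂ ∷ X̂ :- δ̂ ∷ [])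
  weightₚ = Vec.lookup (# 1 ∷ # 1 ∷ δ̂ ∷ μ̂₁ :* (# 1 :+ δ̂) ∷ μ̂₂ :* (# 1 :+ δ̂) ∷ [])

  matrixₚ : SquareMatrix (Polynomial 4) 5
  matrixₚ i j = (if does (i ≟ j) then diagonalₚ i else # 0) :+ :- (# (adjacent i j) :* weightₚ j)

  module _ (X : Carrier) (m₁ m₂ d : ℕ) where
    ρ : Env 4
    ρ = X ∷ Vec.map ψ (+ m₁ ∷ + m₂ ∷ + d ∷ [])

    -- X, n₁ - 1, n₂ - 1 and k - 2 are four independent variables here, so a single normalisation of
    -- both sides covers all parameters.
    det-5×5 : ∣ Quotient.weighted (λ i → ⟦ diagonalₚ i ⟧ ρ) (λ i j → ψ (+ adjacent i j)) id
        (λ i → ⟦ weightₚ i ⟧ ρ) ∣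
            ≈ eval X (quintic (+ suc m₁) (+ suc m₂) (+ suc (suc d)))
    det-5×5 = begin
      ∣ Quotient.weighted (λ i → ⟦ diagonalₚ i ⟧ ρ) (λ i j → ψ (+ adjacent i j)) id (λ i → ⟦ weightₚ i ⟧ ρ) ∣
        ≈⟨ det-cong {M = Quotient.weighted (λ i → ⟦ diagonalₚ i ⟧ ρ) (λ i j → ψ (+ adjacent i j)) id
            (λ i → ⟦ weightₚ i ⟧ ρ)}
             {N = λ i j → ⟦ matrixₚ i j ⟧ ρ} (λ i j → +-congʳ (diagonal i j)) ⟩
      ∣ (λ i j → ⟦ matrixₚ i j ⟧ ρ) ∣
        ≈⟨ ⟦det⟧ ρ matrixₚ ⟨
      ⟦ det (polynomials 4) matrixₚ ⟧ ρ
        ≈⟨ prove ρ (det (polynomials 4) matrixₚ) (foldr (λ p q → p :+ X̂ :* q) (# 0) (quinticₚ μ̂₁ μ̂₂ δ̂))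
            refl ⟩
      ⟦ foldr (λ p q → p :+ X̂ :* q) (# 0) (quinticₚ μ̂₁ μ̂₂ δ̂) ⟧ ρ
        -- At these integers `evalℤ` turns `quinticₚ` into `quintic` by computation, since 1 + m and
        -- 2 + d reduce to successors.
        ≈⟨ eval-map X (quinticₚ (var 0F) (var 1F) (var 2F)) (+ m₁ ∷ + m₂ ∷ + d ∷ []) ⟨
      eval X (quintic (+ suc m₁) (+ suc m₂) (+ suc (suc d))) ∎
      where
      diagonal : ∀ i j → only i j (⟦ diagonalₚ i ⟧ ρ) ≈ ⟦ if does (i ≟ j) then diagonalₚ i else # 0 ⟧ ρ
      diagonal i j with does (i ≟ j)
      ... | true  = refl
      ... | false = sym 0-homo

-- The ring of polynomials as coefficient lists

module Polynomials {c ℓ} (R : CommutativeRing c ℓ) where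
  open CommutativeRing R hiding (zero) renaming (_+_ to _⊞_; _*_ to _·_; -_ to ⊟_)
  open import Algebra.Properties.Ring ring
  open import Algebra.Properties.CommutativeSemigroup +-commutativeSemigroup using (interchange)
  open import Relation.Binary.Reasoning.Setoid setoid

  open RawRing (polynomialRing rawRing) public
    using () renaming (Carrier to Poly; _≈_ to _≋_; _+_ to infixl 6 _⊕_; _*_ to infixl 7 _⊛_; -_ to infix 8 -_)

  infixl 9 _at_
  _at_ : Poly → ℕ → Carrier
  []      at _     = 0#
  (a ∷ p) at zero  = a
  (a ∷ p) at suc n = p at n

  infix 4 _≐_
  _≐_ : Poly → Poly → Set ℓ
  p ≐ q = ∀ n → p at n ≈ q at n

  -- The coefficient function inside `_≋_` is local to `polynomialRing` and has no accessible name.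
  -- Matching on both lists makes it reduce to the same values as `_at_`.
  ≋⇒≐ : ∀ p q → p ≋ q → p ≐ q
  ≋⇒≐ []      []      h n       = refl
  ≋⇒≐ []      (b ∷ q) h zero    = h zero
  ≋⇒≐ []      (b ∷ q) h (suc n) = ≋⇒≐ [] q (λ n → h (suc n)) n
  ≋⇒≐ (a ∷ p) []      h zero    = h zero
  ≋⇒≐ (a ∷ p) []      h (suc n) = ≋⇒≐ p [] (λ n → h (suc n)) n
  ≋⇒≐ (a ∷ p) (b ∷ q) h zero    = h zero
  ≋⇒≐ (a ∷ p) (b ∷ q) h (suc n) = ≋⇒≐ p q (λ n → h (suc n)) n

  ≐⇒≋ : ∀ p q → p ≐ q → p ≋ q
  ≐⇒≋ []      []      h n       = refl
  ≐⇒≋ []      (b ∷ q) h zero    = h zero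
  ≐⇒≋ []      (b ∷ q) h (suc n) = ≐⇒≋ [] q (λ n → h (suc n)) n
  ≐⇒≋ (a ∷ p) []      h zero    = h zero
  ≐⇒≋ (a ∷ p) []      h (suc n) = ≐⇒≋ p [] (λ n → h (suc n)) n
  ≐⇒≋ (a ∷ p) (b ∷ q) h zero    = h zero
  ≐⇒≋ (a ∷ p) (b ∷ q) h (suc n) = ≐⇒≋ p q (λ n → h (suc n)) n

  at-+ : ∀ p q n → (p ⊕ q) at n ≈ p at n ⊞ q at n
  at-+ []      q       n       = sym (+-identityˡ _)
  at-+ (a ∷ p) []      n       = sym (+-identityʳ _)
  at-+ (a ∷ p) (b ∷ q) zero    = refl
  at-+ (a ∷ p) (b ∷ q) (suc n) = at-+ p q n

  at-neg : ∀ p n → (- p) at n ≈ ⊟ (p at n)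
  at-neg []      n       = sym -0#≈0#
  at-neg (a ∷ p) zero    = refl
  at-neg (a ∷ p) (suc n) = at-neg p n

  at-scale : ∀ a p n → map (a ·_) p at n ≈ a · (p at n)
  at-scale a []      n       = sym (zeroʳ a)
  at-scale a (b ∷ p) zero    = refl
  at-scale a (b ∷ p) (suc n) = at-scale a p n

  at-*-∷ : ∀ a p q n → ((a ∷ p) ⊛ q) at n ≈ a · (q at n) ⊞ (0# ∷ p ⊛ q) at n
  at-*-∷ a p q n = trans (at-+ (map (a ·_) q) (0# ∷ p ⊛ q) n) (+-congʳ (at-scale a q n))

  *-congˡ′ : ∀ p {q r} → q ≐ r → p ⊛ q ≐ p ⊛ r
  *-congˡ′ []      q≐r n = refl
  *-congˡ′ (a ∷ p) {q} {r} q≐r n = begin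
    ((a ∷ p) ⊛ q) at n                       ≈⟨ at-*-∷ a p q n ⟩
    a · (q at n) ⊞ (0# ∷ p ⊛ q) at n         ≈⟨ +-cong (*-congˡ (q≐r n)) (shift n) ⟩
    a · (r at n) ⊞ (0# ∷ p ⊛ r) at n         ≈⟨ at-*-∷ a p r n ⟨
    ((a ∷ p) ⊛ r) at n                       ∎
    where
    shift : 0# ∷ p ⊛ q ≐ 0# ∷ p ⊛ r
    shift zero    = refl
    shift (suc n) = *-congˡ′ p q≐r n

  *-distribˡ-+ : ∀ p q r → p ⊛ (q ⊕ r) ≐ p ⊛ q ⊕ p ⊛ r
  *-distribˡ-+ []      q r n = refl
  *-distribˡ-+ (a ∷ p) q r n = begin
    ((a ∷ p) ⊛ (q ⊕ r)) at n
      ≈⟨ at-*-∷ a p (q ⊕ r) n ⟩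
    a · ((q ⊕ r) at n) ⊞ (0# ∷ p ⊛ (q ⊕ r)) at n
      ≈⟨ +-cong (trans (*-congˡ (at-+ q r n)) (distribˡ _ _ _)) (shift n) ⟩
    (a · (q at n) ⊞ a · (r at n)) ⊞ ((0# ∷ p ⊛ q) at n ⊞ (0# ∷ p ⊛ r) at n)
      ≈⟨ interchange _ _ _ _ ⟩
    (a · (q at n) ⊞ (0# ∷ p ⊛ q) at n) ⊞ (a · (r at n) ⊞ (0# ∷ p ⊛ r) at n)
      ≈⟨ +-cong (at-*-∷ a p q n) (at-*-∷ a p r n) ⟨
    ((a ∷ p) ⊛ q) at n ⊞ ((a ∷ p) ⊛ r) at n
      ≈⟨ at-+ ((a ∷ p) ⊛ q) ((a ∷ p) ⊛ r) n ⟨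
    ((a ∷ p) ⊛ q ⊕ (a ∷ p) ⊛ r) at n ∎
    where
    shift : ∀ n → (0# ∷ p ⊛ (q ⊕ r)) at n ≈ (0# ∷ p ⊛ q) at n ⊞ (0# ∷ p ⊛ r) at n
    shift zero    = sym (+-identityˡ 0#)
    shift (suc n) = trans (*-distribˡ-+ p q r n) (at-+ (p ⊛ q) (p ⊛ r) n)

  *-zeroʳ : ∀ p → p ⊛ [] ≐ []
  *-zeroʳ []      n       = refl
  *-zeroʳ (a ∷ p) zero    = refl
  *-zeroʳ (a ∷ p) (suc n) = *-zeroʳ p n

  -- The counterpart of `at-*-∷` for the right factor. Together the two recursions give
  -- commutativity by induction.
  *-∷ : ∀ p b q n → (p ⊛ (b ∷ q)) at n ≈ b · (p at n) ⊞ (0# ∷ p ⊛ q) at n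
  *-∷ []      b q zero    = sym (trans (+-identityʳ _) (zeroʳ b))
  *-∷ []      b q (suc n) = sym (trans (+-identityʳ _) (zeroʳ b))
  *-∷ (a ∷ p) b q zero    = +-congʳ (*-comm a b)
  *-∷ (a ∷ p) b q (suc n) = begin
    ((a ∷ p) ⊛ (b ∷ q)) at suc n                             ≈⟨ at-*-∷ a p (b ∷ q) (suc n) ⟩
    a · (q at n) ⊞ (p ⊛ (b ∷ q)) at n                        ≈⟨ +-congˡ (*-∷ p b q n) ⟩
    a · (q at n) ⊞ (b · (p at n) ⊞ (0# ∷ p ⊛ q) at n)        ≈⟨ x∙yz≈y∙xz _ _ _ ⟩
    b · (p at n) ⊞ (a · (q at n) ⊞ (0# ∷ p ⊛ q) at n)        ≈⟨ +-congˡ (at-*-∷ a p q n) ⟨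
    b · (p at n) ⊞ ((a ∷ p) ⊛ q) at n                        ∎
    where open import Algebra.Properties.CommutativeSemigroup +-commutativeSemigroup using (x∙yz≈y∙xz)

  *-comm′ : ∀ p q → p ⊛ q ≐ q ⊛ p
  *-comm′ []      q n = sym (*-zeroʳ q n)
  *-comm′ (a ∷ p) q n = begin
    ((a ∷ p) ⊛ q) at n                   ≈⟨ at-*-∷ a p q n ⟩
    a · (q at n) ⊞ (0# ∷ p ⊛ q) at n     ≈⟨ +-congˡ (shift n) ⟩
    a · (q at n) ⊞ (0# ∷ q ⊛ p) at n     ≈⟨ *-∷ q a p n ⟨
    (q ⊛ (a ∷ p)) at n                   ∎
    where
    shift : 0# ∷ p ⊛ q ≐ 0# ∷ q ⊛ p
    shift zero    = refl
    shift (suc n) = *-comm′ p q n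

  *-distribʳ-+ : ∀ r p q → (p ⊕ q) ⊛ r ≐ p ⊛ r ⊕ q ⊛ r
  *-distribʳ-+ r p q n = begin
    ((p ⊕ q) ⊛ r) at n             ≈⟨ *-comm′ (p ⊕ q) r n ⟩
    (r ⊛ (p ⊕ q)) at n             ≈⟨ *-distribˡ-+ r p q n ⟩
    (r ⊛ p ⊕ r ⊛ q) at n           ≈⟨ at-+ (r ⊛ p) (r ⊛ q) n ⟩
    (r ⊛ p) at n ⊞ (r ⊛ q) at n    ≈⟨ +-cong (*-comm′ r p n) (*-comm′ r q n) ⟩
    (p ⊛ r) at n ⊞ (q ⊛ r) at n    ≈⟨ at-+ (p ⊛ r) (q ⊛ r) n ⟨
    (p ⊛ r ⊕ q ⊛ r) at n           ∎

  scale-* : ∀ a q r n → (map (a ·_) q ⊛ r) at n ≈ a · ((q ⊛ r) at n)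
  scale-* a []      r n = sym (zeroʳ a)
  scale-* a (b ∷ q) r n = begin
    ((a · b ∷ map (a ·_) q) ⊛ r) at n                      ≈⟨ at-*-∷ (a · b) (map (a ·_) q) r n ⟩
    a · b · (r at n) ⊞ (0# ∷ map (a ·_) q ⊛ r) at n        ≈⟨ +-cong (*-assoc a b _) (shift n) ⟩
    a · (b · (r at n)) ⊞ a · ((0# ∷ q ⊛ r) at n)           ≈⟨ distribˡ a _ _ ⟨
    a · (b · (r at n) ⊞ (0# ∷ q ⊛ r) at n)                 ≈⟨ *-congˡ (at-*-∷ b q r n) ⟨
    a · (((b ∷ q) ⊛ r) at n)                               ∎
    where
    shift : ∀ n → (0# ∷ map (a ·_) q ⊛ r) at n ≈ a · ((0# ∷ q ⊛ r) at n)
    shift zero    = sym (zeroʳ a)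
    shift (suc n) = scale-* a q r n

  *-assoc′ : ∀ p q r → (p ⊛ q) ⊛ r ≐ p ⊛ (q ⊛ r)
  *-assoc′ []      q r n = refl
  *-assoc′ (a ∷ p) q r n = begin
    (((a ∷ p) ⊛ q) ⊛ r) at n
      ≈⟨ *-distribʳ-+ r (map (a ·_) q) (0# ∷ p ⊛ q) n ⟩
    (map (a ·_) q ⊛ r ⊕ (0# ∷ p ⊛ q) ⊛ r) at n
      ≈⟨ at-+ (map (a ·_) q ⊛ r) _ n ⟩
    (map (a ·_) q ⊛ r) at n ⊞ ((0# ∷ p ⊛ q) ⊛ r) at n
      ≈⟨ +-cong (scale-* a q r n) (at-*-∷ 0# (p ⊛ q) r n) ⟩
    a · ((q ⊛ r) at n) ⊞ (0# · (r at n) ⊞ (0# ∷ (p ⊛ q) ⊛ r) at n)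
      ≈⟨ +-congˡ (trans (+-cong (zeroˡ _) (shift n)) (+-identityˡ _)) ⟩
    a · ((q ⊛ r) at n) ⊞ (0# ∷ p ⊛ (q ⊛ r)) at n
      ≈⟨ at-*-∷ a p (q ⊛ r) n ⟨
    ((a ∷ p) ⊛ (q ⊛ r)) at n ∎
    where
    shift : 0# ∷ (p ⊛ q) ⊛ r ≐ 0# ∷ p ⊛ (q ⊛ r)
    shift zero    = refl
    shift (suc n) = *-assoc′ p q r n

  *-identityˡ′ : ∀ p → (1# ∷ []) ⊛ p ≐ p
  *-identityˡ′ p n = trans (at-*-∷ 1# [] p n) (trans (+-cong (*-identityˡ _) (zeros n)) (+-identityʳ _))
    where
    zeros : 0# ∷ [] ≐ []
    zeros zero    = refl
    zeros (suc n) = refl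

  commutativeRing : CommutativeRing c ℓ
  commutativeRing = record
    { RawRing (polynomialRing rawRing)
    ; isCommutativeRing = record
      { isRing = record
        { +-isAbelianGroup = record
          { isGroup = record
            { isMonoid = record
              { isSemigroup = record
                { isMagma = record
                  { isEquivalence = record
                    { refl  = λ {p} → ≐⇒≋ p p λ n → refl
                    ; sym   = λ {p} {q} h → ≐⇒≋ q p λ n → sym (≋⇒≐ p q h n)
                    ; trans = λ {p} {q} {r} h h′ → ≐⇒≋ p r λ n → trans (≋⇒≐ p q h n) (≋⇒≐ q r h′ n)
                    }
                  ; ∙-cong = λ {p} {p′} {q} {q′} h h′ → ≐⇒≋ (p ⊕ q) (p′ ⊕ q′) λ n →
                      trans (at-+ p q n) (trans (+-cong (≋⇒≐ p p′ h n) (≋⇒≐ q q′ h′ n)) (sym (at-+ p′ q′ n)))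
                  }
                ; assoc = λ p q r → ≐⇒≋ ((p ⊕ q) ⊕ r) (p ⊕ (q ⊕ r)) λ n → begin
                    ((p ⊕ q) ⊕ r) at n               ≈⟨ at-+ (p ⊕ q) r n ⟩
                    (p ⊕ q) at n ⊞ r at n            ≈⟨ +-congʳ (at-+ p q n) ⟩
                    p at n ⊞ q at n ⊞ r at n         ≈⟨ +-assoc _ _ _ ⟩
                    p at n ⊞ (q at n ⊞ r at n)       ≈⟨ +-congˡ (at-+ q r n) ⟨
                    p at n ⊞ (q ⊕ r) at n            ≈⟨ at-+ p (q ⊕ r) n ⟨
                    (p ⊕ (q ⊕ r)) at n               ∎
                }
              ; identity = (λ p → ≐⇒≋ p p λ n → refl)
                         , (λ p → ≐⇒≋ (p ⊕ []) p λ n → trans (at-+ p [] n) (+-identityʳ _))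
              }
            ; inverse = (λ p → ≐⇒≋ (- p ⊕ p) [] λ n → trans (at-+ (- p) p n)
                          (trans (+-congʳ (at-neg p n)) (-‿inverseˡ _)))
                      , (λ p → ≐⇒≋ (p ⊕ - p) [] λ n → trans (at-+ p (- p) n)
                          (trans (+-congˡ (at-neg p n)) (-‿inverseʳ _)))
            ; ⁻¹-cong = λ {p} {q} h → ≐⇒≋ (- p) (- q) λ n →
                trans (at-neg p n) (trans (-‿cong (≋⇒≐ p q h n)) (sym (at-neg q n)))
            }
          ; comm = λ p q → ≐⇒≋ (p ⊕ q) (q ⊕ p) λ n →
              trans (at-+ p q n) (trans (+-comm _ _) (sym (at-+ q p n)))
          }
        ; *-cong = λ {p} {p′} {q} {q′} h h′ → ≐⇒≋ (p ⊛ q) (p′ ⊛ q′) λ n → begin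
            (p ⊛ q) at n      ≈⟨ *-congˡ′ p (≋⇒≐ q q′ h′) n ⟩
            (p ⊛ q′) at n     ≈⟨ *-comm′ p q′ n ⟩
            (q′ ⊛ p) at n     ≈⟨ *-congˡ′ q′ (≋⇒≐ p p′ h) n ⟩
            (q′ ⊛ p′) at n    ≈⟨ *-comm′ q′ p′ n ⟩
            (p′ ⊛ q′) at n    ∎
        ; *-assoc = λ p q r → ≐⇒≋ ((p ⊛ q) ⊛ r) (p ⊛ (q ⊛ r)) (*-assoc′ p q r)
        ; *-identity = (λ p → ≐⇒≋ ((1# ∷ []) ⊛ p) p (*-identityˡ′ p))
                     , (λ p → ≐⇒≋ (p ⊛ (1# ∷ [])) p λ n →
                          trans (*-comm′ p (1# ∷ []) n) (*-identityˡ′ p n))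
        ; distrib = (λ p q r → ≐⇒≋ (p ⊛ (q ⊕ r)) (p ⊛ q ⊕ p ⊛ r) (*-distribˡ-+ p q r))
                  , (λ r p q → ≐⇒≋ ((p ⊕ q) ⊛ r) (p ⊛ r ⊕ q ⊛ r) (*-distribʳ-+ r p q))
        }
      ; *-comm = λ p q → ≐⇒≋ (p ⊛ q) (q ⊛ p) (*-comm′ p q)
      }
    }

  X : Poly
  X = 0# ∷ 1# ∷ []

  C : Carrier → Poly
  C a = a ∷ []

  module K[X] = CommutativeRing commutativeRing

  ∷-cong : ∀ {a b p q} → a ≈ b → p ≋ q → (a ∷ p) ≋ (b ∷ q)
  ∷-cong a≈b p≋q zero    = a≈b
  ∷-cong a≈b p≋q (suc n) = p≋q n

  C-cong : ∀ {a b} → a ≈ b → C a ≋ C b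
  C-cong {a} {b} a≈b = ∷-cong {p = []} {[]} a≈b (K[X].refl {[]})

  C-0 : C 0# ≋ []
  C-0 zero    = refl
  C-0 (suc n) = refl

  C-* : ∀ a b → C (a · b) ≋ C a ⊛ C b
  C-* a b = ∷-cong {p = []} {[]} (sym (+-identityʳ _)) (K[X].refl {[]})

  ∷≋C+X* : ∀ a p → (a ∷ p) ≋ C a ⊕ X ⊛ p
  ∷≋C+X* a p = ≐⇒≋ (a ∷ p) (C a ⊕ X ⊛ p) λ n → sym (begin
    (C a ⊕ X ⊛ p) at n                                    ≈⟨ at-+ (C a) (X ⊛ p) n ⟩
    C a at n ⊞ (X ⊛ p) at n                               ≈⟨ +-congˡ (at-*-∷ 0# (1# ∷ []) p n) ⟩
    C a at n ⊞ (0# · (p at n) ⊞ (0# ∷ (1# ∷ []) ⊛ p) at n)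
      ≈⟨ +-congˡ (trans (+-congʳ (zeroˡ _)) (+-identityˡ _)) ⟩
    C a at n ⊞ (0# ∷ (1# ∷ []) ⊛ p) at n                  ≈⟨ coefficients n ⟩
    (a ∷ p) at n                                          ∎)
    where
    coefficients : ∀ n → C a at n ⊞ (0# ∷ (1# ∷ []) ⊛ p) at n ≈ (a ∷ p) at n
    coefficients zero    = +-identityʳ a
    coefficients (suc n) = trans (+-identityˡ _) (*-identityˡ′ p n)

  linear≋ : ∀ a → (a ∷ 1# ∷ []) ≋ X ⊕ C a
  linear≋ a = ∷-cong {p = 1# ∷ []} {1# ∷ []} (sym (+-identityˡ a)) (K[X].refl {1# ∷ []})

  Regular : Poly → Set (c ⊔ ℓ)
  Regular p = ∀ q → p ⊛ q ≋ [] → q ≋ []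

  -- Coefficient n + 1 of the product is the n-th coefficient of q plus a times the next one. Beyond
  -- the end of the list the coefficients are 0, so each vanishes once its successor does. The
  -- descent is a structural induction on q and needs no leading nonzero coefficient to be found.
  linear-regular : ∀ a → Regular (X ⊕ C a)
  linear-regular a q h = ≐⇒≋ q [] (vanish q step)
    where
    step : ∀ n → q at n ⊞ a · (q at suc n) ≈ 0#
    step n = begin
      q at n ⊞ a · (q at suc n)                              ≈⟨ +-comm _ _ ⟩
      a · (q at suc n) ⊞ q at n
        ≈⟨ +-cong (*-congʳ (sym (+-identityˡ a))) (sym (*-identityˡ′ q n)) ⟩
      (0# ⊞ a) · (q at suc n) ⊞ (0# ∷ (1# ∷ []) ⊛ q) at suc n  ≈⟨ at-*-∷ (0# ⊞ a) (1# ∷ []) q (suc n) ⟨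
      ((X ⊕ C a) ⊛ q) at suc n                               ≈⟨ ≋⇒≐ ((X ⊕ C a) ⊛ q) [] h (suc n) ⟩
      0#                                                     ∎

    vanish : ∀ q → (∀ n → q at n ⊞ a · (q at suc n) ≈ 0#) → q ≐ []
    vanish []      h n       = refl
    vanish (b ∷ q) h (suc n) = vanish q (λ n → h (suc n)) n
    vanish (b ∷ q) h zero    = begin
      b                     ≈⟨ +-identityʳ b ⟨
      b ⊞ 0#                ≈⟨ +-congˡ (trans (*-congˡ (vanish q (λ n → h (suc n)) zero)) (zeroʳ a)) ⟨
      b ⊞ a · (q at zero)   ≈⟨ h zero ⟩
      0#                    ∎

-- Sums and products over the vertices, cell by cell

quotient-↑ˡ : ∀ n {d} (i : Fin d) → quotient {suc n} d (i ↑ˡ n * d) ≡ zero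
quotient-↑ˡ n {d} i rewrite splitAt-↑ˡ d i (n * d) = ≡.refl

quotient-↑ʳ : ∀ n d (i : Fin (n * d)) → quotient {suc n} d (d ↑ʳ i) ≡ suc (quotient d i)
quotient-↑ʳ n d i rewrite splitAt-↑ʳ d (n * d) i = ≡.refl

module CellSummation {c ℓ} (M : CommutativeMonoid c ℓ) where
  open CommutativeMonoid M
  open Summation M
  open import Algebra.Definitions.RawMonoid rawMonoid using (_×_)
  open import Relation.Binary.Reasoning.Setoid setoid

  ∑-quotient : ∀ n d (F : Vector Carrier n) → ∑ (F ∘ quotient {n} d) ≈ ∑ (λ i → d × F i)
  ∑-quotient zero    d F = trans (∑-empty _) (sym (∑-empty _))
  ∑-quotient (suc n) d F = begin
    ∑ (F ∘ quotient {suc n} d)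
      ≈⟨ ∑-++ d _ ⟩
    ∑ (λ i → F (quotient {suc n} d (i ↑ˡ n * d))) ∙ ∑ (λ i → F (quotient {suc n} d (d ↑ʳ i)))
      ≈⟨ ∙-cong (∑-cong λ i → reflexive (≡.cong F (quotient-↑ˡ n i)))
                (∑-cong λ i → reflexive (≡.cong F (quotient-↑ʳ n d i))) ⟩
    ∑ {d} (λ i → F zero) ∙ ∑ (F ∘ suc ∘ quotient {n} d)
      ≈⟨ ∙-cong (∑-const d (F zero)) (∑-quotient n d (F ∘ suc)) ⟩
    d × F zero ∙ ∑ (λ i → d × F (suc i))
      ≈⟨ ∑-suc _ ⟨
    ∑ (λ i → d × F i) ∎

  module _ (m₁ m₂ d : ℕ) where
    open Cells m₁ m₂ d

    ∑-oldCell : (F : Vector Carrier (suc (suc size))) →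
      ∑ (F ∘ oldCell) ≈ (F 0F ∙ F 1F) ∙ ∑ (λ e → F (suc (suc (suc e))))
    ∑-oldCell F = begin
      ∑ (F ∘ oldCell)
        ≈⟨ ∑-++ (suc m₁) _ ⟩
      ∑ (λ i → F (oldCell (i ↑ˡ suc m₂))) ∙ ∑ (λ j → F (oldCell (suc m₁ ↑ʳ j)))
        ≈⟨ ∙-cong (∑-cong λ i → reflexive (≡.cong (F ∘ [ cellˡ , cellʳ ]′) (splitAt-↑ˡ (suc m₁) i (suc m₂))))
                  (∑-cong λ j → reflexive (≡.cong (F ∘ [ cellˡ , cellʳ ]′) (splitAt-↑ʳ (suc m₁) (suc m₂) j))) ⟩
      ∑ (F ∘ cellˡ) ∙ ∑ (F ∘ cellʳ)
        ≈⟨ ∙-cong (∑-suc _) (∑-suc _) ⟩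
      (F 0F ∙ ∑ (λ i → P (i ↑ˡ m₂))) ∙ (F 1F ∙ ∑ (λ j → P (m₁ ↑ʳ j)))
        ≈⟨ interchange _ _ _ _ ⟩
      (F 0F ∙ F 1F) ∙ (∑ (λ i → P (i ↑ˡ m₂)) ∙ ∑ (λ j → P (m₁ ↑ʳ j)))
        ≈⟨ ∙-congˡ (∑-++ m₁ P) ⟨
      (F 0F ∙ F 1F) ∙ ∑ P ∎
      where
      open import Algebra.Properties.CommutativeSemigroup commutativeSemigroup using (interchange)
      P : Vector Carrier (m₁ + m₂)
      P e = F (suc (suc (suc e)))

    -- The first factor collects the vertices of the double star, namely the centres and one leaf
    -- per pendant edge; the second collects the d new vertices of every edge. An arbitrary monoid
    -- is allowed because this serves both for the weights, additively, and for the product of the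
    -- values of t, multiplicatively.
    ∑-cell : (F : Vector Carrier (suc (suc size))) →
      ∑ (F ∘ cell) ≈ ((F 0F ∙ F 1F) ∙ ∑ (λ e → F (suc (suc (suc e))))) ∙ ∑ (λ e → d × F (suc (suc e)))
    ∑-cell F = begin
      ∑ (F ∘ cell)
        ≈⟨ ∑-++ (suc m₁ + suc m₂) _ ⟩
      ∑ (λ i → F (cell (i ↑ˡ size * d))) ∙ ∑ (λ x → F (cell ((suc m₁ + suc m₂) ↑ʳ x)))
        ≈⟨ ∙-cong (∑-cong λ i → reflexive (≡.cong (F ∘ [ oldCell , newCell ]′)
            (splitAt-↑ˡ (suc m₁ + suc m₂) i (size * d))))
                  (∑-cong λ x → reflexive (≡.cong (F ∘ [ oldCell , newCell ]′)
                      (splitAt-↑ʳ (suc m₁ + suc m₂) (size * d) x))) ⟩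
      ∑ (F ∘ oldCell) ∙ ∑ (F ∘ newCell)
        ≈⟨ ∙-cong (∑-oldCell F) (∑-quotient size d (λ e → F (suc (suc e)))) ⟩
      _ ∎

    ∑-pendantColour : (F : Vector Carrier 5) → ∑ (F ∘ pendantColour) ≈ m₁ × F 3F ∙ m₂ × F 4F
    ∑-pendantColour F = begin
      ∑ (F ∘ pendantColour)
        ≈⟨ ∑-++ m₁ _ ⟩
      ∑ (λ i → F (pendantColour (i ↑ˡ m₂))) ∙ ∑ (λ j → F (pendantColour (m₁ ↑ʳ j)))
        ≈⟨ ∙-cong (∑-cong λ i → reflexive (≡.cong (F ∘ [ (λ _ → 3F) , (λ _ → 4F) ]′) (splitAt-↑ˡ m₁ i m₂)))
                  (∑-cong λ j → reflexive (≡.cong (F ∘ [ (λ _ → 3F) , (λ _ → 4F) ]′) (splitAt-↑ʳ m₁ m₂ j))) ⟩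
      ∑ {m₁} (λ _ → F 3F) ∙ ∑ {m₂} (λ _ → F 4F)
        ≈⟨ ∙-cong (∑-const m₁ _) (∑-const m₂ _) ⟩
      m₁ × F 3F ∙ m₂ × F 4F ∎

-- Cancellation of regular elements

module RegularElements {c ℓ} (R : CommutativeRing c ℓ) where
  open CommutativeRing R hiding (zero) renaming (_+_ to _⊞_; _*_ to _·_)
  open import Algebra.Properties.Ring ring
  open import Algebra.Definitions.RawSemiring (RawRing.rawSemiring rawRing) using (_^_)
  open import Relation.Binary.Reasoning.Setoid setoid

  Regular : Carrier → Set (c ⊔ ℓ)
  Regular x = ∀ y → x · y ≈ 0# → y ≈ 0#

  regular-cong : ∀ {x y} → x ≈ y → Regular x → Regular y
  regular-cong x≈y x-regular z yz≈0 = x-regular z (trans (*-congʳ x≈y) yz≈0)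

  regular-* : ∀ {x y} → Regular x → Regular y → Regular (x · y)
  regular-* x-regular y-regular z xyz≈0 =
    y-regular z (x-regular _ (trans (sym (*-assoc _ _ _)) xyz≈0))

  regular-^ : ∀ {x} n → Regular x → Regular (x ^ n)
  regular-^ zero    x-regular z 1z≈0 = trans (sym (*-identityˡ z)) 1z≈0
  regular-^ (suc n) x-regular = regular-* x-regular (regular-^ n x-regular)

  regular-cancelˡ : ∀ {x} → Regular x → ∀ y z → x · y ≈ x · z → y ≈ z
  regular-cancelˡ {x} x-regular y z xy≈xz = x∙y⁻¹≈ε⇒x≈y y z (x-regular (y ⊞ - z) (begin
    x · (y ⊞ - z)        ≈⟨ distribˡ x y (- z) ⟩
    x · y ⊞ x · - z      ≈⟨ +-cong xy≈xz (sym (-‿distribʳ-* x z)) ⟩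
    x · z ⊞ - (x · z)    ≈⟨ -‿inverseʳ _ ⟩
    0#                   ∎))

-- The characteristic determinant of the double hyperstar

module AdjacencyDeterminant {c ℓ} (R : CommutativeRing c ℓ)
  (ψ-homo : ℤ.+-*-rawRing -Raw-AlmostCommutative⟶ fromCommutativeRing R)
  (X : CommutativeRing.Carrier R)
  (X+ψ-regular : ∀ i → RegularElements.Regular R
      (CommutativeRing._+_ R X (_-Raw-AlmostCommutative⟶_.⟦_⟧ ψ-homo i)))
  (a b d′ : ℕ) where

  open CommutativeRing R hiding (zero) renaming (_+_ to _⊞_; _*_ to _·_)
  open Determinant R
  open RegularElements R
  open IntegerPolynomials R ψ-homo
  open Summation *-commutativeMonoid using () renaming
      (∑ to ∏; ∑-suc to ∏-suc; ∑-empty to ∏-empty; ∑-cong to ∏-cong; ∑-const to ∏-const)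
  module ∑C = CellSummation +-commutativeMonoid
  module ∏C = CellSummation *-commutativeMonoid
  open import Algebra.Properties.Ring ring
  open import Algebra.Properties.Semiring.Exp semiring using (_^_; ^-homo-*; ^-assocʳ; ^-congˡ)
  open import Algebra.Properties.Semiring.Mult semiring using (_×_; ×-congʳ; ×-assoc-*)
  open import Relation.Binary.Reasoning.Setoid setoid

  -- Thus n₁ = a + 2, n₂ = b + 2 and k = d′ + 3. These lower bounds make the truncated subtractions
  -- in `e₁` and `e₂` exact.
  m₁ m₂ d : ℕ
  m₁ = suc a
  m₂ = suc b
  d  = suc d′

  e₁ e₂ : ℕ
  e₁ = d * (suc m₁ + suc m₂ ∸ 1) ∸ 1
  e₂ = suc m₁ + suc m₂ ∸ 4

  open Cells m₁ m₂ d

  open Hypergraph H using (order)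

  ×1≈ψ : ∀ n → n × 1# ≈ ψ (+ n)
  ×1≈ψ zero    = sym 0-homo
  ×1≈ψ (suc n) = trans (+-cong (sym 1-homo) (×1≈ψ n)) (sym (+-homo (+ 1) (+ n)))

  y s : Carrier
  y = X ⊞ ψ (+ 1)
  s = X ⊞ - ψ (+ d)

  X-regular : Regular X
  X-regular = regular-cong (trans (+-congˡ 0-homo) (+-identityʳ X)) (X+ψ-regular (+ 0))

  s-regular : Regular s
  s-regular = regular-cong (+-congˡ (-‿homo (+ d))) (X+ψ-regular (ℤ.- + d))

  characteristic : Matrix order
  characteristic i j = only i j X ⊞ - ψ (+ adjacency H i j)

  ∑-only : ∀ {n} (j : Fin n) (x : Vector Carrier n) → ∑ (λ i → only i j (x i)) ≈ x j
  ∑-only zero    x = trans (∑-suc _) (trans (+-congˡ (∑-zero λ i → refl)) (+-identityʳ _))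
  ∑-only (suc j) x = trans (∑-suc _) (trans (+-identityˡ _) (∑-only j (x ∘ suc)))

  ×-zero : ∀ n → n × 0# ≈ 0#
  ×-zero zero    = refl
  ×-zero (suc n) = trans (+-identityˡ _) (×-zero n)

  ×-only : ∀ {k} n (i j : Fin k) x → n × only i j x ≈ only i j (n × x)
  ×-only n i j x with does (i ≟ j)
  ... | true  = refl
  ... | false = ×-zero n

  -- `B` contributes `common c c` at each diagonal position, where the adjacency matrix has 0; the
  -- second summand compensates for it. On edge cells it is 1, which is where the eigenvalue -1
  -- comes from.
  t : Vector Carrier (suc (suc size))
  t c = X ⊞ ψ (+ common c c)

  B : Matrix (suc (suc size))
  B c c′ = ψ (+ common c c′)

  weight : Vector Carrier (suc (suc size))
  weight zero                = 1#
  weight (suc zero)          = 1#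
  weight (suc (suc zero))    = ψ (+ d)
  weight (suc (suc (suc e))) = 1# ⊞ ψ (+ d)

  open Quotient t B

  characteristic≈weighted : ∀ i j → characteristic i j ≈ weighted cell (λ _ → 1#) i j
  characteristic≈weighted i j rewrite adjacency-cell i j with i ≟ j
  ... | no _       = +-congˡ (-‿cong (sym (*-identityʳ _)))
  ... | yes ≡.refl = begin
    X ⊞ - ψ (+ 0)              ≈⟨ +-congˡ (trans (-‿cong 0-homo) -0#≈0#) ⟩
    X ⊞ 0#                     ≈⟨ +-congˡ (-‿inverseʳ β) ⟨
    X ⊞ (β ⊞ - β)              ≈⟨ +-assoc _ _ _ ⟨
    X ⊞ β ⊞ - β                ≈⟨ +-congˡ (-‿cong (*-identityʳ β)) ⟨
    X ⊞ β ⊞ - (β · 1#)         ∎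
    where β = ψ (+ common (cell i) (cell i))

  t-edge : ∀ e → t (suc (suc e)) ≈ y
  t-edge e = +-congˡ (reflexive (≡.cong (λ n → ψ (+ n)) (common-edge-self e)))

  fibreSum-cell : ∀ c → fibreSum cell (λ _ → 1#) c ≈ weight c
  fibreSum-cell c = trans (∑C.∑-cell m₁ m₂ d (λ x → only x c 1#)) (trans
    (+-congˡ (∑-cong λ e → trans (×-only d (suc (suc e)) c 1#) (only-cong (suc (suc e)) c (×1≈ψ d))))
    (evaluate c))
    where
    evaluate : ∀ c → only 0F c 1# ⊞ only 1F c 1# ⊞ ∑ (λ e → only (suc (suc (suc e))) c 1#)
      ⊞ ∑ (λ e → only (suc (suc e)) c (ψ (+ d))) ≈ weight c
    evaluate zero       = trans (+-cong (+-cong (+-identityʳ _) (∑-zero λ e → refl)) (∑-zero λ e → refl))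
                                (trans (+-identityʳ _) (+-identityʳ _))
    evaluate (suc zero) = trans (+-cong (+-cong (+-identityˡ _) (∑-zero λ e → refl)) (∑-zero λ e → refl))
                                (trans (+-identityʳ _) (+-identityʳ _))
    evaluate (suc (suc zero))    = trans
      (+-cong (trans (+-cong (+-identityˡ _) (∑-zero λ e → refl)) (+-identityˡ _))
          (∑-only zero (λ _ → ψ (+ d))))
      (+-identityˡ _)
    evaluate (suc (suc (suc e))) = +-cong
      (trans (+-cong (+-identityˡ _) (∑-only e (λ _ → 1#))) (+-identityˡ _))
      (∑-only (suc e) (λ _ → ψ (+ d)))

  -- The left side counts the vertices other than the centres, each of which gives a factor `y`. Of
  -- these factors, `size` are cancelled by those of the adjoined indices, one for each edge cell.
  exponents : (m₁ + m₂) + d * size ≡ e₁ + size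
  exponents = ≡.trans (ℕ-rearrange (m₁ + m₂) (d′ * size))
    (≡.cong (λ n → (d * n ∸ 1) + size) (≡.sym (ℕ.+-suc m₁ m₂)))
    where
    ℕ-rearrange : ∀ m x → m + (suc m + x) ≡ (m + x) + suc m
    ℕ-rearrange m x = ≡.trans (≡.sym (ℕ.+-assoc m (suc m) x))
      (≡.trans (≡.cong (λ n → n + x) (ℕ.+-comm m (suc m)))
        (≡.trans (ℕ.+-assoc (suc m) m x) (ℕ.+-comm (suc m) (m + x))))

  det-cells : ∣ characteristic ∣ ≈ y ^ e₁ · ∣ weighted id weight ∣
  det-cells = regular-cancelˡ ∏t-regular _ _ (begin
    ∏ t · ∣ characteristic ∣
      ≈⟨ trans (*-congˡ (det-cong characteristic≈weighted)) (*-comm _ _) ⟩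
    ∣ weighted cell (λ _ → 1#) ∣ · ∏ t
      ≈⟨ det-quotient cell (λ _ → 1#) ⟩
    ∏ (t ∘ cell) · ∣ weighted id (fibreSum cell (λ _ → 1#)) ∣
      ≈⟨ *-cong ∏-t-cell (det-weights-cong id fibreSum-cell) ⟩
    (∏ t · y ^ e₁) · ∣ weighted id weight ∣
      ≈⟨ *-assoc _ _ _ ⟩
    ∏ t · (y ^ e₁ · ∣ weighted id weight ∣) ∎)
    where
    ∏t≈ : ∏ t ≈ (t 0F · t 1F) · y ^ size
    ∏t≈ = trans (∏-suc _) (trans (*-congˡ (trans (∏-suc _) (*-congˡ (trans (∏-cong t-edge) (∏-const size y)))))
      (sym (*-assoc _ _ _)))

    ∏t-regular : Regular (∏ t)
    ∏t-regular = regular-cong (sym ∏t≈)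
      (regular-* (regular-* (X+ψ-regular _) (X+ψ-regular _)) (regular-^ size (X+ψ-regular (+ 1))))

    ∏-t-cell : ∏ (t ∘ cell) ≈ ∏ t · y ^ e₁
    ∏-t-cell = begin
      ∏ (t ∘ cell)
        ≈⟨ ∏C.∑-cell m₁ m₂ d t ⟩
      ((t 0F · t 1F) · ∏ (λ e → t (suc (suc (suc e))))) · ∏ (λ e → t (suc (suc e)) ^ d)
        ≈⟨ *-cong (*-congˡ (trans (∏-cong (t-edge ∘ suc)) (∏-const (m₁ + m₂) y)))
                  (trans (∏-cong (λ e → ^-congˡ d (t-edge e))) (∏-const size (y ^ d))) ⟩
      ((t 0F · t 1F) · y ^ (m₁ + m₂)) · (y ^ d) ^ size
        ≈⟨ trans (*-congˡ (^-assocʳ y d size)) (*-assoc _ _ _) ⟩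
      (t 0F · t 1F) · (y ^ (m₁ + m₂) · y ^ (d * size))
        ≈⟨ *-congˡ (^-homo-* y (m₁ + m₂) (d * size)) ⟨
      (t 0F · t 1F) · y ^ ((m₁ + m₂) + d * size)
        ≈⟨ *-congˡ (reflexive (≡.cong (y ^_) exponents)) ⟩
      (t 0F · t 1F) · y ^ (e₁ + size)
        ≈⟨ *-congˡ (trans (^-homo-* y e₁ size) (*-comm _ _)) ⟩
      (t 0F · t 1F) · (y ^ size · y ^ e₁)
        ≈⟨ *-assoc _ _ _ ⟨
      (t 0F · t 1F) · y ^ size · y ^ e₁
        ≈⟨ *-congʳ ∏t≈ ⟨
      ∏ t · y ^ e₁ ∎

  ρ₅ : Env 4
  ρ₅ = ρ X m₁ m₂ d

  t₅ w₅ : Vector Carrier 5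
  t₅ i = ⟦ diagonalₚ i ⟧ ρ₅
  w₅ i = ⟦ weightₚ i ⟧ ρ₅

  B₅ : Matrix 5
  B₅ i j = ψ (+ adjacent i j)

  module Q₅ = Quotient t₅ B₅

  diagonal-centre : ∀ β → X ⊞ β ⊞ - (β · 1#) ≈ X ⊞ - (ψ (+ 0) · 1#)
  diagonal-centre β = trans (+-assoc _ _ _) (+-congˡ (trans (+-congˡ (-‿cong (*-identityʳ β)))
    (trans (-‿inverseʳ β) (sym (trans (-‿cong (trans (*-congʳ 0-homo) (zeroˡ _))) -0#≈0#)))))

  -- Changing the self-adjacency of a pendant cell from 1 to 0 moves its weight into the diagonal
  -- term: X + 1 - (1 + d) = X - d. This is the origin of the eigenvalue k - 2.
  diagonal-pendant : y ⊞ - (ψ (+ 1) · (1# ⊞ ψ (+ d))) ≈ s ⊞ - (ψ (+ 0) · (1# ⊞ ψ (+ d)))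
  diagonal-pendant = begin
    X ⊞ ψ (+ 1) ⊞ - (ψ (+ 1) · (1# ⊞ ψ (+ d)))
      ≈⟨ +-cong (+-congˡ 1-homo) (-‿cong (trans (*-congʳ 1-homo) (*-identityˡ _))) ⟩
    X ⊞ 1# ⊞ - (1# ⊞ ψ (+ d))
      ≈⟨ trans (+-assoc _ _ _) (+-congˡ (trans (+-congˡ (sym (-‿+-comm _ _))) (sym (+-assoc _ _ _)))) ⟩
    X ⊞ (1# ⊞ - 1# ⊞ - ψ (+ d))                  ≈⟨ +-congˡ (trans (+-congʳ (-‿inverseʳ 1#)) (+-identityˡ _)) ⟩
    s                                            ≈⟨ +-identityʳ s ⟨
    s ⊞ 0#
      ≈⟨ +-congˡ (trans (-‿cong (trans (*-congʳ 0-homo) (zeroˡ _))) -0#≈0#) ⟨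
    s ⊞ - (ψ (+ 0) · (1# ⊞ ψ (+ d)))             ∎

  diagonal-entry : ∀ c → t c ⊞ - (B c c · weight c) ≈ t₅ (colour c) ⊞ - (B₅ (colour c) (colour c) · weight c)
  diagonal-entry zero       = diagonal-centre (ψ (+ common 0F 0F))
  diagonal-entry (suc zero) = diagonal-centre (ψ (+ common 1F 1F))
  diagonal-entry (suc (suc zero)) rewrite common-edge-self zero = refl
  diagonal-entry (suc (suc (suc e))) rewrite common-edge-self (suc e) with splitAt m₁ e
  ... | inj₁ _ = diagonal-pendant
  ... | inj₂ _ = diagonal-pendant

  -- One matrix in two presentations: the result of the first merging, and the input of the second.
  -- Off the diagonal `common` depends only on the colours; on the diagonal `t₅` makes up for the
  -- difference between `B` and `B₅`.
  weighted≈weighted₅ : ∀ c c′ → weighted id weight c c′ ≈ Q₅.weighted colour weight c c′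
  weighted≈weighted₅ c c′ with c ≟ c′
  ... | yes ≡.refl = diagonal-entry c
  ... | no c≢c′    = +-congˡ (-‿cong
      (*-congʳ (reflexive (≡.cong (λ n → ψ (+ n)) (common≡adjacent m₁ m₂ d c c′ c≢c′)))))

  weight-pendant : ∀ n → n × (1# ⊞ ψ (+ d)) ≈ ψ (+ n) · (ψ (+ 1) ⊞ ψ (+ d))
  weight-pendant n = begin
    n × (1# ⊞ ψ (+ d))               ≈⟨ ×-congʳ n (*-identityˡ _) ⟨
    n × (1# · (1# ⊞ ψ (+ d)))        ≈⟨ ×-assoc-* n 1# _ ⟨
    (n × 1#) · (1# ⊞ ψ (+ d))        ≈⟨ *-cong (×1≈ψ n) (+-congʳ (sym 1-homo)) ⟩
    ψ (+ n) · (ψ (+ 1) ⊞ ψ (+ d))    ∎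

  fibreSum-colour : ∀ c → Q₅.fibreSum colour weight c ≈ w₅ c
  fibreSum-colour c = begin
    Q₅.fibreSum colour weight c
      ≈⟨ trans (∑-suc _) (+-congˡ (trans (∑-suc _) (+-congˡ (trans (∑-suc _) (+-congˡ
           (∑C.∑-pendantColour m₁ m₂ d (λ i → only i c (1# ⊞ ψ (+ d))))))))) ⟩
    only 0F c 1# ⊞ (only 1F c 1# ⊞ (only 2F c (ψ (+ d))
      ⊞ (m₁ × only 3F c (1# ⊞ ψ (+ d)) ⊞ m₂ × only 4F c (1# ⊞ ψ (+ d)))))
      ≈⟨ +-congˡ (+-congˡ (+-congˡ (+-cong (×-only m₁ 3F c _) (×-only m₂ 4F c _)))) ⟩
    only 0F c 1# ⊞ (only 1F c 1# ⊞ (only 2F c (ψ (+ d))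
      ⊞ (only 3F c (m₁ × (1# ⊞ ψ (+ d))) ⊞ only 4F c (m₂ × (1# ⊞ ψ (+ d))))))
      ≈⟨ +-cong (only-cong 0F c (sym 1-homo)) (+-cong (only-cong 1F c (sym 1-homo)) (+-congˡ
           (+-cong (only-cong 3F c (weight-pendant m₁)) (trans (only-cong 4F c (weight-pendant m₂))
               (sym (+-identityʳ _)))))) ⟩
    only 0F c (w₅ 0F) ⊞ (only 1F c (w₅ 1F) ⊞
        (only 2F c (w₅ 2F) ⊞ (only 3F c (w₅ 3F) ⊞ (only 4F c (w₅ 4F) ⊞ 0#))))
      ≈⟨ trans (∑-suc _) (+-congˡ (trans (∑-suc _) (+-congˡ (trans (∑-suc _) (+-congˡ
           (trans (∑-suc _) (+-congˡ (trans (∑-suc _) (+-congˡ (∑-empty _)))))))))) ⟨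
    ∑ (λ i → only i c (w₅ i))
      ≈⟨ ∑-only c w₅ ⟩
    w₅ c ∎

  det-colours : ∣ weighted id weight ∣ ≈ s ^ e₂ · ∣ Q₅.weighted id w₅ ∣
  det-colours = regular-cancelˡ ∏t₅-regular _ _ (begin
    ∏ t₅ · ∣ weighted id weight ∣
      ≈⟨ trans (*-congˡ (det-cong weighted≈weighted₅)) (*-comm _ _) ⟩
    ∣ Q₅.weighted colour weight ∣ · ∏ t₅
      ≈⟨ Q₅.det-quotient colour weight ⟩
    ∏ (t₅ ∘ colour) · ∣ Q₅.weighted id (Q₅.fibreSum colour weight) ∣
      ≈⟨ *-cong ∏-t₅-colour (Q₅.det-weights-cong id fibreSum-colour) ⟩
    (∏ t₅ · s ^ e₂) · ∣ Q₅.weighted id w₅ ∣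
      ≈⟨ *-assoc _ _ _ ⟩
    ∏ t₅ · (s ^ e₂ · ∣ Q₅.weighted id w₅ ∣) ∎)
    where
    ∏t₅≈ : ∏ t₅ ≈ X · (X · (y · (s · s)))
    ∏t₅≈ = trans (∏-suc _) (*-congˡ (trans (∏-suc _) (*-congˡ (trans (∏-suc _) (*-congˡ
      (trans (∏-suc _) (*-congˡ (trans (∏-suc _) (trans (*-congˡ (∏-empty _)) (*-identityʳ _))))))))))

    ∏t₅-regular : Regular (∏ t₅)
    ∏t₅-regular = regular-cong (sym ∏t₅≈) (regular-* X-regular (regular-* X-regular
      (regular-* (X+ψ-regular (+ 1)) (regular-* s-regular s-regular))))

    -- Each of the m₁ + m₂ pendant cells gives a factor `s`, and two of these factors are cancelled
    -- by those of the two pendant colours.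
    exponents₅ : m₁ + m₂ ≡ 2 + e₂
    exponents₅ = ≡.trans (≡.cong suc (ℕ.+-suc a b)) (≡.cong (λ n → 2 + n)
      (≡.sym (≡.cong (_∸ 2) (≡.trans (ℕ.+-suc a (suc b)) (≡.cong suc (ℕ.+-suc a b))))))

    ∏-t₅-colour : ∏ (t₅ ∘ colour) ≈ ∏ t₅ · s ^ e₂
    ∏-t₅-colour = begin
      ∏ (t₅ ∘ colour)
        ≈⟨ trans (∏-suc _) (*-congˡ (trans (∏-suc _) (*-congˡ (trans (∏-suc _) (*-congˡ
             (∏C.∑-pendantColour m₁ m₂ d t₅)))))) ⟩
      X · (X · (y · (s ^ m₁ · s ^ m₂)))
        ≈⟨ *-congˡ (*-congˡ (*-congˡ (begin
             s ^ m₁ · s ^ m₂                                  ≈⟨ ^-homo-* s m₁ m₂ ⟨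
             s ^ (m₁ + m₂)                                    ≈⟨ reflexive (≡.cong (s ^_) exponents₅) ⟩
             s · (s · s ^ e₂)              ≈⟨ *-assoc _ _ _ ⟨
             s · s · s ^ e₂                ∎))) ⟩
      X · (X · (y · (s · s · s ^ e₂)))
        ≈⟨ trans (*-assoc _ _ _) (*-congˡ (trans (*-assoc _ _ _) (*-congˡ (*-assoc _ _ _)))) ⟨
      X · (X · (y · (s · s))) · s ^ e₂
        ≈⟨ *-congʳ ∏t₅≈ ⟨
      ∏ t₅ · s ^ e₂ ∎

  det-characteristic : ∣ characteristic ∣ ≈
    y ^ e₁ · (s ^ e₂
      · eval X (quintic (+ suc m₁) (+ suc m₂) (+ suc (suc d))))
  det-characteristic = trans det-cells (*-congˡ (trans det-colours (*-congˡ (det-5×5 X m₁ m₂ d))))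

-- Factorisation of the characteristic polynomial over a Heyting field

module _ {c ℓ} (R : CommutativeRing c ℓ) where
  open CommutativeRing R hiding (zero) renaming (_+_ to _⊞_; _*_ to _·_)
  open import Algebra.Definitions.RawSemiring (RawRing.rawSemiring rawRing) using (_^_)

  open import Relation.Binary.Reasoning.Setoid setoid

  ^-cong : ∀ n {x y} → x ≈ y → x ^ n ≈ y ^ n
  ^-cong zero    x≈y = refl
  ^-cong (suc n) x≈y = *-cong x≈y (^-cong n x≈y)

  module _ {a} {A : Set a} (f : A → Carrier) where

    ∏-map : List A → Carrier
    ∏-map = foldr (λ r q → f r · q) 1#

    ∏-map-replicate-++ : ∀ n r rs → ∏-map (replicate n r ++ rs) ≈ f r ^ n · ∏-map rs
    ∏-map-replicate-++ zero    r rs = sym (*-identityˡ _)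
    ∏-map-replicate-++ (suc n) r rs = trans (*-congˡ (∏-map-replicate-++ n r rs)) (sym (*-assoc _ _ _))

    factorisation : ∀ m n r r′ rs {x y s z} → x ≈ y ^ m · (s ^ n · z) →
      y ≈ f r → s ≈ f r′ → z ≈ ∏-map rs → x ≈ ∏-map (replicate m r ++ replicate n r′ ++ rs)
    factorisation m n r r′ rs {x} {y} {s} {z} x≈ y≈ s≈ z≈ = begin
      x                                                  ≈⟨ x≈ ⟩
      y ^ m · (s ^ n · z)                                ≈⟨ *-cong (^-cong m y≈) (*-cong (^-cong n s≈) z≈) ⟩
      f r ^ m · (f r′ ^ n · ∏-map rs)                    ≈⟨ *-congˡ (∏-map-replicate-++ n r′ rs) ⟨
      f r ^ m · ∏-map (replicate n r′ ++ rs)             ≈⟨ ∏-map-replicate-++ m r _ ⟨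
      ∏-map (replicate m r ++ replicate n r′ ++ rs)      ∎

module _ {c ℓ₁ ℓ₂} (K : HeytingField c ℓ₁ ℓ₂) where
  open Spectra K using (fromℕ; fromℤ; charPoly; adjacencyMatrix; RootsOf; Spectrum)

  R : CommutativeRing c ℓ₁
  R = HeytingCommutativeRing.commutativeRing (HeytingField.heytingCommutativeRing K)

  open CommutativeRing R hiding (zero) renaming (_+_ to _⊞_; _*_ to _·_)
  open import Algebra.Properties.Ring ring
  open import Algebra.Properties.Semiring.Mult semiring using (×-homo-+; ×1-homo-*)
  open import Relation.Binary.Reasoning.Setoid setoid
  open Polynomials R using (Poly; X; C; C-cong; C-*; C-0; linear≋; linear-regular; ∷≋C+X*)
    renaming (commutativeRing to R[X])
  module P = CommutativeRing R[X]

  fromℕ-+ : ∀ m n → fromℕ (m + n) ≈ fromℕ m ⊞ fromℕ n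
  fromℕ-+ = ×-homo-+ 1#

  fromℤ-⊖ : ∀ m n → fromℤ (m ℤ.⊖ n) ≈ fromℕ m ⊞ - fromℕ n
  fromℤ-⊖ m       zero    = sym (trans (+-congˡ -0#≈0#) (+-identityʳ _))
  fromℤ-⊖ zero    (suc n) = sym (+-identityˡ _)
  fromℤ-⊖ (suc m) (suc n) = begin
    fromℤ (suc m ℤ.⊖ suc n)              ≈⟨ reflexive (≡.cong fromℤ (ℤ.[1+m]⊖[1+n]≡m⊖n m n)) ⟩
    fromℤ (m ℤ.⊖ n)                      ≈⟨ fromℤ-⊖ m n ⟩
    fromℕ m ⊞ - fromℕ n                  ≈⟨ +-congˡ (+-identityˡ _) ⟨
    fromℕ m ⊞ (0# ⊞ - fromℕ n)           ≈⟨ +-congˡ (+-congʳ (-‿inverseʳ 1#)) ⟨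
    fromℕ m ⊞ (1# ⊞ - 1# ⊞ - fromℕ n)    ≈⟨ +-congˡ (trans (+-assoc _ _ _) (+-congˡ (-‿+-comm _ _))) ⟩
    fromℕ m ⊞ (1# ⊞ - (1# ⊞ fromℕ n))    ≈⟨ trans (sym (+-assoc _ _ _)) (+-congʳ (+-comm _ _)) ⟩
    1# ⊞ fromℕ m ⊞ - (1# ⊞ fromℕ n)      ∎

  fromℤ-+ : ∀ i j → fromℤ (i ℤ.+ j) ≈ fromℤ i ⊞ fromℤ j
  fromℤ-+ (+ m)    (+ n)    = fromℕ-+ m n
  fromℤ-+ (+ m)    -[1+ n ] = fromℤ-⊖ m (suc n)
  fromℤ-+ -[1+ m ] (+ n)    = trans (fromℤ-⊖ n (suc m)) (+-comm _ _)
  fromℤ-+ -[1+ m ] -[1+ n ] = begin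
    - fromℕ (suc (suc (m + n)))           ≈⟨ -‿cong (reflexive (≡.cong (λ n → fromℕ (suc n)) (ℕ.+-suc m n))) ⟨
    - fromℕ (suc m + suc n)               ≈⟨ -‿cong (fromℕ-+ (suc m) (suc n)) ⟩
    - (fromℕ (suc m) ⊞ fromℕ (suc n))     ≈⟨ -‿+-comm _ _ ⟨
    - fromℕ (suc m) ⊞ - fromℕ (suc n)     ∎

  fromℤ-neg : ∀ i → fromℤ (ℤ.- i) ≈ - fromℤ i
  fromℤ-neg (+ zero)  = sym -0#≈0#
  fromℤ-neg (+ suc n) = refl
  fromℤ-neg -[1+ n ]  = sym (-‿involutive _)

  fromℤ-+◃ : ∀ n → fromℤ (Sign.+ ℤ.◃ n) ≈ fromℕ n
  fromℤ-+◃ n = reflexive (≡.cong fromℤ (ℤ.+◃n≡+n n))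

  fromℤ--◃ : ∀ n → fromℤ (Sign.- ℤ.◃ n) ≈ - fromℕ n
  fromℤ--◃ n = trans (reflexive (≡.cong fromℤ (ℤ.-◃n≡-n n))) (fromℤ-neg (+ n))

  fromℤ-* : ∀ i j → fromℤ (i ℤ.* j) ≈ fromℤ i · fromℤ j
  fromℤ-* (+ m)    (+ n)    = trans (fromℤ-+◃ (m * n)) (×1-homo-* m n)
  fromℤ-* (+ m)    -[1+ n ] = trans (fromℤ--◃ (m * suc n))
    (trans (-‿cong (×1-homo-* m (suc n))) (-‿distribʳ-* _ _))
  fromℤ-* -[1+ m ] (+ n)    = trans (fromℤ--◃ (suc m * n))
    (trans (-‿cong (×1-homo-* (suc m) n)) (-‿distribˡ-* _ _))
  fromℤ-* -[1+ m ] -[1+ n ] = begin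
    fromℕ (suc m * suc n)                  ≈⟨ ×1-homo-* (suc m) (suc n) ⟩
    fromℕ (suc m) · fromℕ (suc n)          ≈⟨ -‿involutive _ ⟨
    - - (fromℕ (suc m) · fromℕ (suc n))    ≈⟨ -‿cong (-‿distribˡ-* _ _) ⟩
    - (- fromℕ (suc m) · fromℕ (suc n))    ≈⟨ -‿distribʳ-* _ _ ⟩
    - fromℕ (suc m) · - fromℕ (suc n)      ∎

  ψ-homo : ℤ.+-*-rawRing -Raw-AlmostCommutative⟶ fromCommutativeRing R[X]
  ψ-homo = record
    { ⟦_⟧    = λ i → C (fromℤ i)
    ; +-homo = λ i j → C-cong (fromℤ-+ i j)
    ; *-homo = λ i j → P.trans {C (fromℤ (i ℤ.* j))} {C (fromℤ i · fromℤ j)} {C (fromℤ i) P.* C (fromℤ j)}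
                 (C-cong (fromℤ-* i j)) (C-* (fromℤ i) (fromℤ j))
    ; -‿homo = λ i → C-cong (fromℤ-neg i)
    ; 0-homo = C-0
    ; 1-homo = C-cong (+-identityʳ 1#)
    }

  linearFactor : Carrier → Poly
  linearFactor r = - r ∷ 1# ∷ []

  module _ (a b d′ : ℕ) where
    open AdjacencyDeterminant R[X] ψ-homo X (λ i → linear-regular (fromℤ i)) a b d′
    open Cells m₁ m₂ d using (H)
    open IntegerPolynomials R[X] ψ-homo using (eval)
    open Determinant R[X] using (det-cong)
    open import Algebra.Definitions.RawSemiring (RawRing.rawSemiring P.rawRing) using (_^_)

    -- Evaluation at the indeterminate gives back the polynomial itself. This identifies the value
    -- of the 5 × 5 determinant with the coefficient list whose roots are given.
    eval-X : ∀ is → eval X is P.≈ map fromℤ is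
    eval-X []       = C-0
    eval-X (i ∷ is) = P.trans {eval X (i ∷ is)} {C (fromℤ i) P.+ X P.* map fromℤ is} {map fromℤ (i ∷ is)}
      (P.+-congˡ {C (fromℤ i)} {X P.* eval X is} {X P.* map fromℤ is}
        (P.*-congˡ {X} {eval X is} {map fromℤ is} (eval-X is)))
      (P.sym {map fromℤ (i ∷ is)} {C (fromℤ i) P.+ X P.* map fromℤ is} (∷≋C+X* (fromℤ i) (map fromℤ is)))

    charPoly≈ : charPoly (adjacencyMatrix H) P.≈ det P.rawRing characteristic
    charPoly≈ = det-cong {M = XI-A} {N = characteristic} λ i j →
        entry (does (i ≟ j)) (- fromℕ (adjacency H i j))
      where
      XI-A : SquareMatrix Poly (Hypergraph.order H)
      XI-A i j = if does (i ≟ j) then - fromℕ (adjacency H i j) ∷ 1# ∷ [] else - fromℕ (adjacency H i j) ∷ []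

      entry : ∀ b x → (if b then x ∷ 1# ∷ [] else x ∷ []) P.≈ (if b then X else []) P.+ C x
      entry true  x = linear≋ x
      entry false x = P.refl {C x}

    y≈ : y P.≈ linearFactor (- 1#)
    y≈ = P.trans {y} {X P.+ C (- - 1#)} {linearFactor (- 1#)}
      (P.+-congˡ {X} {C (fromℕ 1)} {C (- - 1#)} (C-cong (trans (+-identityʳ 1#) (sym (-‿involutive 1#)))))
      (P.sym {linearFactor (- 1#)} {X P.+ C (- - 1#)} (linear≋ (- - 1#)))

    s≈ : s P.≈ linearFactor (fromℕ d)
    s≈ = P.sym {linearFactor (fromℕ d)} {s} (linear≋ (- fromℕ d))

    spectrum : ∀ rs → RootsOf (map fromℤ (quintic (+ suc m₁) (+ suc m₂) (+ suc (suc d)))) rs →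
      Spectrum (adjacencyMatrix H) (replicate e₁ (- 1#) ++ replicate e₂ (fromℕ d) ++ rs)
    spectrum rs roots = factorisation R[X] linearFactor e₁ e₂ (- 1#) (fromℕ d) rs {charPoly (adjacencyMatrix H)}
        {y} {s} {eval X is}
      (P.trans {charPoly (adjacencyMatrix H)} {det P.rawRing characteristic} {y ^ e₁ P.* (s ^ e₂ P.* eval X is)}
          charPoly≈ det-characteristic)
      y≈ s≈
      (P.trans {eval X is} {map fromℤ is} {∏-map R[X] linearFactor rs} (eval-X is) roots)
      where
      is : List ℤ
      is = quintic (+ suc m₁) (+ suc m₂) (+ suc (suc d))

theorem5p1 : ∀ {c ℓ₁ ℓ₂} (K : HeytingField c ℓ₁ ℓ₂) → let open Spectra K in
    (n₁ n₂ k : ℕ) .{{_ : NonZero n₁}} .{{_ : NonZero n₂}} → 2 ≤ n₁ → 2 ≤ n₂ → 3 ≤ k →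
    (r₁ r₂ r₃ r₄ r₅ : Carrier) →
    RootsOf (map fromℤ (quintic (+ n₁) (+ n₂) (+ k))) (r₁ ∷ r₂ ∷ r₃ ∷ r₄ ∷ r₅ ∷ []) →
    Spectrum (adjacencyMatrix (doubleHyperstar n₁ n₂ k))
    (replicate ((k ∸ 2) * (n₁ + n₂ ∸ 1) ∸ 1) (- 1#)
    ++ replicate (n₁ + n₂ ∸ 4) (fromℕ (k ∸ 2))
    ++ r₁ ∷ r₂ ∷ r₃ ∷ r₄ ∷ r₅ ∷ [])
theorem5p1 K (suc (suc a)) (suc (suc b)) (suc (suc (suc d))) 2≤n₁ 2≤n₂ 3≤k r₁ r₂ r₃ r₄ r₅ =
  spectrum K a b d (r₁ ∷ r₂ ∷ r₃ ∷ r₄ ∷ r₅ ∷ [])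
theorem5p1 K (suc (suc a)) (suc (suc b)) (suc (suc zero)) 2≤n₁ 2≤n₂ (s≤s (s≤s ()))
theorem5p1 K (suc (suc a)) (suc (suc b)) (suc zero) 2≤n₁ 2≤n₂ (s≤s ())
theorem5p1 K (suc (suc a)) (suc zero) k 2≤n₁ (s≤s ())
theorem5p1 K (suc zero) n₂ k (s≤s ())
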